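{- Suppose $k\ge 3$ and $n\ge 3$ is odd. Then (for any of the choices made in its construction) $Z_k(n)$ is an Eulerian subgraph of the de Bruijn digraph $B_k(n)$, and there exists a maximal $\mathcal{NAS}_k(n+1)$.
   Context: Sequences. For a sequence $S=(s_i)_{i\ge0}$ over $\mathbb{Z}_k$ write $\mathbf{s}_r(i)=(s_i,\dots,s_{i+r-1})$; an $r$-tuple occurs in $S$ if it equals some $\mathbf{s}_r(i)$. A $k$-ary $r$-window sequence is a periodic sequence over $\mathbb{Z}_k$, of period $m$ say, such that $\mathbf{s}_r(i)=\mathbf{s}_r(j)$ implies $i\equiv j\pmod m$. For $k\ge3$, $r\ge2$, an $\mathcal{NAS}_k(r)$ is a $k$-ary $r$-window sequence such that whenever an $r$-tuple $\mathbf{a}$ occurs in it, $-\mathbf{a}$ (entrywise negation) does not. It is maximal if its period is $\frac{k^r-1}{2}$ ($k$ odd) or $\frac{k^r-2^r}{2}$ ($k$ even). Graphs. For $r\ge1$, $B_k(r)$ is the digraph on $\mathbb{Z}_k^r$ with an edge from $(x_0,\dots,x_{r-1})$ to $(x_1,\dots,x_{r-1},y)$ for all $x_i,y$; this edge is identified with the $(r+1)$-tuple $(x_0,\dots,x_{r-1},y)$. A digraph is Eulerian if it is connected and every vertex has in-degree equal to out-degree. The graph $W_k(n-1)$. Let $f:\mathbb{Z}_k\to\mathbb{Q}$ be $f(u)=u$ (as an integer in $[1,k-1]$) for $u\ne0$ and $f(0)=k/2$; the pseudoweight of $\mathbf{u}=(u_0,\dots,u_{n-1})$ is $w^*(\mathbf{u})=\sum_i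 f(u_i)\in\mathbb{Q}$. Let $E_k(n)$ be the set of $k$-ary $n$-tuples with pseudoweight less than $nk/2$. For an $n$-tuple $(a_0,\dots,a_{n-1})$, the circuit $[a_0,\dots,a_{n-1}]$ in $B_k(n-1)$ consists of the edges given by all distinct cyclic rotations of $(a_0,\dots,a_{n-1})$. A tuple is self-negative if it equals its negative; a circuit is self-negative if its tuples are. Let $\mathcal{C}^*_k(n-1)$ be the set of non-self-negative circuits $[a_0,\dots,a_{n-1}]$ with $w^*(a_0,\dots,a_{n-1})=kn/2$. For $n$ odd these circuits come in pairs consisting of a circuit and its (distinct) negative. Choose one circuit from each pair; let $F_k(n)$ be the union of $E_k(n)$ and the set of all $n$-tuples in the chosen circuits, and let $W_k(n-1)$ be the subgraph of $B_k(n-1)$ with edge set $F_k(n)$ and vertices those incident with these edges. The Lempel homomorphism. $D(a_0,\dots,a_{r-1})=(a_1-a_0,\dots,a_{r-1}-a_{r-2})$ maps vertices and edges of $B_k(n)$ to those of $B_k(n-1)$; $D^{ -1}(W_k(n-1))$ is the subgraph of $B_k(n)$ consisting of all edges and vertices mapped by $D$ to edges and vertices of $W_k(n-1)$. The circuits $\mathbf{b}_x$, $x\in\mathbb{Z}_k$. If $k$ is odd, $\mathbf{b}_x$ is the circuit of $B_k(n)$ consisting of the single edge (loop) given by the $(n+1)$-tuple $(x,x,\dots,x)$. If $k$ is even, let $T_k(n-1)$ be the subgraph of $B_k(n-1)$ whose edges are the $2^n$ $n$-tuples with all entries in $\{0,k/2\}$ (with the vertices on these edges), and fix an Eulerian circuit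 of it, i.e. a cyclic sequence $[a_0,\dots,a_{2^n-1}]$ with entries in $\{0,k/2\}$ in which every $n$-tuple over $\{0,k/2\}$ occurs exactly once (cyclically). Put $b_i=\sum_{j=0}^i a_j\in\mathbb{Z}_k$, so that $b_{2^n-1}=0$; then $\mathbf{b}_x$ is the circuit in $B_k(n)$ whose edges are the $2^n$ $(n+1)$-tuples of cyclically consecutive terms of the cyclic sequence $[x+b_0,x+b_1,\dots,x+b_{2^n-2},x]$. The graph $Z_k(n)$ is the subgraph of $B_k(n)$ whose edges are the edges of $D^{ -1}(W_k(n-1))$ together with the edges of $\mathbf{b}_x$ for all integers $x$ with $0<x<k/2$ (and whose vertices are those on these edges). -}

module Defs where

open import Data.Fin.Base as Fin using (Fin; toℕ)
open import Data.Integer.Base using (+_)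
open import Data.List.Base using (List; length)
open import Data.List.Membership.Propositional using () renaming (_∈_ to _∈ˡ_)
open import Data.List.Relation.Unary.Unique.Propositional using (Unique)
open import Data.Nat.Base using (ℕ; zero; suc; NonZero; _+_; _*_; _∸_; _^_; _<_; ∣_-_∣)
open import Data.Nat.DivMod using (_/_; _mod_)
open import Data.Nat.Divisibility using (_∣_)
open import Data.Nat.Properties using (m^n≢0)
open import Data.Product using (Σ; ∃; ∃!; _×_; _,_)
open import Data.Rational.Base as ℚ using (ℚ; 0ℚ)
open import Data.Sum.Base using (_⊎_; inj₁; inj₂)
open import Data.Vec.Base as Vec using (Vec; []; _∷_; map; zipWith; lookup; tabulate; replicate; init; tail)
open import Data.Vec.Relation.Unary.All using (All)
open import Function.Bundles using (_⇔_)
open import Level using (0ℓ)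
open import Relation.Binary.Construct.Closure.Equivalence using (EqClosure)
open import Relation.Binary.PropositionalEquality using (_≡_; refl; cong; subst)
open import Relation.Nullary using (¬_)
open import Relation.Unary using (Pred; _∈_; _∉_)

private
  variable
    A : Set
    k m n r : ℕ

-- ℤ_k is represented by Fin k, the residues 0, …, k - 1.

infixl 6 _⊕_ _⊖_

_⊕_ : Fin k → Fin k → Fin k
_⊕_ {suc k} x y = (toℕ x + toℕ y) mod suc k

⊝_ : Fin k → Fin k
⊝_ {suc k} x = (suc k ∸ toℕ x) mod suc k

_⊖_ : Fin k → Fin k → Fin k
x ⊖ y = x ⊕ (⊝ y)

Tuple : ℕ → ℕ → Set
Tuple k r = Vec (Fin k) r

neg : Tuple k r → Tuple k r
neg = map ⊝_

window : (r : ℕ) → (ℕ → A) → ℕ → Vec A r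
window r s i = tabulate λ j → s (i + toℕ j)

Occurs : (ℕ → Fin k) → Tuple k r → Set
Occurs {r = r} s a = ∃ λ i → window r s i ≡ a

-- The window condition forces p to be the least period of s.
record IsWindowSequence (k r : ℕ) (s : ℕ → Fin k) (p : ℕ) : Set where
  field
    positive : 0 < p
    periodic : ∀ i → s (i + p) ≡ s i
    distinct : ∀ i j → window r s i ≡ window r s j → p ∣ ∣ i - j ∣

record IsNAS (k r : ℕ) (s : ℕ → Fin k) (p : ℕ) : Set where
  field
    isWindowSequence : IsWindowSequence k r s p
    negativeAvoiding : (a : Tuple k r) → Occurs s a → ¬ Occurs s (neg a)

record IsMaximalNAS (k r : ℕ) (s : ℕ → Fin k) (p : ℕ) : Set where
  field
    isNAS       : IsNAS k r s p
    period-odd  : ¬ 2 ∣ k → p ≡ (k ^ r ∸ 1) / 2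
    period-even : 2 ∣ k → p ≡ (k ^ r ∸ 2 ^ r) / 2

-- An edge of B_k(r) is an (r+1)-tuple; it goes from its initial r-tuple
-- to its final r-tuple.
record Subgraph (k r : ℕ) : Set₁ where
  field
    V        : Pred (Tuple k r) 0ℓ
    E        : Pred (Tuple k (suc r)) 0ℓ
    source-V : ∀ e → e ∈ E → init e ∈ V
    target-V : ∀ e → e ∈ E → tail e ∈ V

-- The subgraph formed by a set of edges and the vertices incident with them.
edgeInduced : Pred (Tuple k (suc r)) 0ℓ → Subgraph k r
edgeInduced E = record
  { V        = λ v → ∃ λ e → e ∈ E × (init e ≡ v ⊎ tail e ≡ v)
  ; E        = E
  ; source-V = λ e e∈E → e , e∈E , inj₁ refl
  ; target-V = λ e e∈E → e , e∈E , inj₂ refl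
  }

HasSize : Pred A 0ℓ → ℕ → Set
HasSize {A} P d = Σ (List A) λ xs →
  Unique xs × (∀ x → x ∈ˡ xs ⇔ x ∈ P) × length xs ≡ d

module _ (G : Subgraph k r) where
  open Subgraph G

  InDegree OutDegree : Tuple k r → ℕ → Set
  InDegree  v = HasSize λ e → e ∈ E × tail e ≡ v
  OutDegree v = HasSize λ e → e ∈ E × init e ≡ v

  Adjacent : Tuple k r → Tuple k r → Set
  Adjacent u v = ∃ λ e → e ∈ E × init e ≡ u × tail e ≡ v

  -- Connectedness ignores the direction of the edges.
  record Eulerian : Set where
    field
      connected : ∀ u v → u ∈ V → v ∈ V → EqClosure Adjacent u v
      balanced  : ∀ v → v ∈ V → ∃ λ d → InDegree v d × OutDegree v d

-- A cyclic sequence [c_0,…,c_{m-1}] is a vector, read with indices mod m.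
cyclic : .{{NonZero m}} → Vec A m → ℕ → A
cyclic {m} c i = lookup c (i mod m)

-- The edge set of the circuit in B_k(r) with cyclic sequence c; for
-- m = r + 1 these edges are the cyclic rotations of c.
[_] : .{{NonZero m}} → Tuple k m → Pred (Tuple k (suc r)) 0ℓ
[_] {r = r} c e = ∃ λ i → window (suc r) (cyclic c) i ≡ e

record IsEulerianCircuit (G : Subgraph k r) .{{_ : NonZero m}} (c : Tuple k m) : Set where
  open Subgraph G
  field
    edges : ∀ i → window (suc r) (cyclic c) i ∈ E
    once  : ∀ e → e ∈ E → ∃! _≡_ λ (i : Fin m) → window (suc r) (cyclic c) (toℕ i) ≡ e

-- Here and below m stands for n - 1, so that n = suc m.

f : Fin k → ℚ
f {k} Fin.zero      = + k ℚ./ 2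
f     u@(Fin.suc _) = + toℕ u ℚ./ 1

w* : Tuple k n → ℚ
w* u = Vec.foldr′ ℚ._+_ 0ℚ (map f u)

E* : (k n : ℕ) → Pred (Tuple k n) 0ℓ
E* k n u = w* u ℚ.< + (n * k) ℚ./ 2

SelfNegative : Pred (Tuple k n) 0ℓ
SelfNegative u = neg u ≡ u

-- a ∈ C* k n means that the circuit [ a ] belongs to 𝒞*_k(n-1); this does
-- not depend on the choice of a among its rotations.
C* : (k n : ℕ) → Pred (Tuple k n) 0ℓ
C* k n a = a ∉ SelfNegative × w* a ≡ + (k * n) ℚ./ 2

-- A choice of one circuit from each pair {[ a ], [ neg a ]} in 𝒞*_k(n-1).
-- A set of circuits is given by a rotation-invariant set of tuples.
record CircuitChoice (k m : ℕ) : Set₁ where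
  field
    Chosen    : Pred (Tuple k (suc m)) 0ℓ
    rotation  : ∀ a b → a ∈ Chosen → b ∈ [ a ] → b ∈ Chosen
    sound     : ∀ a → a ∈ Chosen → a ∈ C* k (suc m)
    atLeast   : ∀ a → a ∈ C* k (suc m) → a ∈ Chosen ⊎ neg a ∈ Chosen
    atMost    : ∀ a → a ∈ Chosen → neg a ∉ Chosen

F : CircuitChoice k m → Pred (Tuple k (suc m)) 0ℓ
F {k} {m} choice e = e ∈ E* k (suc m) ⊎ ∃ λ a → a ∈ Chosen × e ∈ [ a ]
  where open CircuitChoice choice

W : CircuitChoice k m → Subgraph k m
W choice = edgeInduced (F choice)

D : Tuple k (suc r) → Tuple k r
D a = zipWith _⊖_ (tail a) (init a)

D-init : (e : Tuple k (suc (suc r))) → init (D e) ≡ D (init e)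
D-init {r = zero}  (x ∷ y ∷ [])     = refl
D-init {r = suc r} (x ∷ y ∷ z ∷ as) = cong ((y ⊖ x) ∷_) (D-init (y ∷ z ∷ as))

D-tail : (e : Tuple k (suc (suc r))) → tail (D e) ≡ D (tail e)
D-tail (x ∷ y ∷ as) = refl

D⁻¹ : Subgraph k r → Subgraph k (suc r)
D⁻¹ G = record
  { V        = λ v → D v ∈ V
  ; E        = λ e → D e ∈ E
  ; source-V = λ e e∈E → subst V (D-init e) (source-V (D e) e∈E)
  ; target-V = λ e e∈E → subst V (D-tail e) (target-V (D e) e∈E)
  }
  where open Subgraph G

-- Used only for even k, where k / 2 is exact.
T : (k m : ℕ) → Subgraph k m
T k m = edgeInduced (All λ a → toℕ a ≡ 0 ⊎ toℕ a ≡ k / 2)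

-- For odd k the construction of the b_x involves no choice.
data BChoice (k m : ℕ) : Set where
  odd  : ¬ 2 ∣ k → BChoice k m
  even : 2 ∣ k → (a : Tuple k (2 ^ suc m)) →
         IsEulerianCircuit (T k m) {{m^n≢0 2 (suc m)}} a → BChoice k m

partialSum : (ℕ → Fin k) → ℕ → Fin k
partialSum s zero    = s 0
partialSum s (suc i) = partialSum s i ⊕ s (suc i)

-- For even k the entry of the cyclic sequence at the last position is
-- x ⊕ b_{2^n-1}, which equals x because b_{2^n-1} = 0.
b : BChoice k m → Fin k → Pred (Tuple k (suc (suc m))) 0ℓ
b         (odd _)      x e = e ≡ replicate _ x
b {m = m} (even _ a _) x   =
  [ tabulate {n = 2 ^ suc m} (λ i → x ⊕ partialSum (cyclic a) (toℕ i)) ]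
  where instance _ = m^n≢0 2 (suc m)

Z : CircuitChoice k m → BChoice k m → Subgraph k (suc m)
Z {k} choice β = edgeInduced λ e →
  e ∈ Subgraph.E (D⁻¹ (W choice)) ⊎
  ∃ λ (x : Fin k) → 0 < toℕ x × 2 * toℕ x < k × e ∈ b β x

{-# OPTIONS --safe #-}

-- Replacing each edge of a circuit by the next one is a permutation of the
-- edges of Z: an edge e whose differences D e lie in F is followed by an edge
-- whose differences are a rotation of D e, and F is closed under rotation; an
-- edge of b_x is followed by the next edge of b_x.  Hence Z is balanced.  It
-- is connected because f ≥ 1: appending the difference 1 never raises the
-- pseudoweight of the differences, so every vertex whose differences leave
-- room for one more 1 is joined to the vertices with all differences equal to
-- 1, and those are joined to each other by the edges between them.  An edge
-- of a chosen circuit reaches such a vertex after rotating an entry of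
-- above-average weight to the front, and the vertices of b_x are such
-- themselves.
--
-- Negation exchanges F with the other tuples that are not self-negative, and
-- b_x with b_{-x}.  So every (n+1)-tuple that is not self-negative is either
-- an edge of Z or the negative of one, and an Eulerian circuit of Z is a
-- maximal NAS.
module Submission where

open import Defs
open import Algebra.Bundles using (AbelianGroup)
import Algebra.Properties.AbelianGroup as AbelianGroupProperties
open import Data.Bool.Base using (if_then_else_; true; false)
open import Data.Fin.Base as Fin using (Fin; toℕ)
open import Data.Fin.Properties as Fin using (toℕ-injective; toℕ-fromℕ<; toℕ<n)
import Data.Integer.Base as ℤ
import Data.Integer.Properties as ℤ
open import Data.List.Base as List using (List; []; _∷_; _++_; length; concat; filter; cartesianProductWith; allFin; applyUpTo)
import Data.List.Properties as Listₚ
open import Data.List.Membership.Propositional using (find; lose) renaming (_∈_ to _∈ˡ_)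
open import Data.List.Membership.Propositional.Properties
  using (∈-∃++; ∈-++⁻; ∈-++⁺ʳ; ∈-++⁺ˡ; ∈-concat⁻′; ∈-filter⁺; ∈-filter⁻; ∈-map⁺; ∈-map⁻; ∈-cartesianProductWith⁺;
         ∈-cartesianProductWith⁻; ∈-allFin; ∈-lookup; ∈-applyUpTo⁺; ∈-applyUpTo⁻)
open import Data.List.Membership.Propositional.Properties.WithK using (unique∧set⇒bag)
open import Data.List.Relation.Binary.BagAndSetEquality using (∼bag⇒↭)
open import Data.List.Relation.Binary.Permutation.Propositional
  using (_↭_; ↭-refl; ↭-sym; ↭-trans; prep; ↭-reflexive; ↭⇒↭ₛ; module PermutationReasoning)
open import Data.List.Relation.Binary.Permutation.Propositional.Properties
  using (↭-length; filter-↭; shift; shifts; ++-comm; ++⁺ˡ; ++⁺ʳ; ∈-resp-↭) renaming (map⁺ to ↭-map⁺)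
import Data.List.Relation.Binary.Permutation.Setoid.Properties as PermutationSetoid
open import Data.List.Relation.Unary.All as Allˡ using ([]; _∷_)
import Data.List.Relation.Unary.All.Properties as Allˡₚ
open import Data.List.Relation.Unary.AllPairs using ([]; _∷_)
open import Data.List.Relation.Unary.Any as Any using (Any; here; there; any?; index)
import Data.List.Relation.Unary.Any.Properties as Anyₚ
open import Data.List.Relation.Unary.Unique.Propositional using (Unique)
import Data.List.Relation.Unary.Unique.Propositional.Properties as Unique
open import Data.Nat.Base
open import Data.Nat.Divisibility using (_∣_; divides; m%n≡0⇒n∣m; >⇒∤; _∣?_)
open import Data.Nat.DivMod
open import Data.Nat.GeneralisedArithmetic using (fold)
open import Data.Nat.ListAction using (sum)
open import Data.Nat.ListAction.Properties using (sum-++; sum-↭)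
open import Data.Nat.Properties
open import Data.Nat.Tactic.RingSolver using (solve-∀)
open import Data.Product using (∃; ∃₂; _×_; _,_; proj₁; proj₂)
open import Data.Rational.Base as ℚ using (ℚ; toℚᵘ)
import Data.Rational.Properties as ℚ
open import Data.Rational.Unnormalised.Base as ℚᵘ using (mkℚᵘ; _≃_; *≡*; *<*)
import Data.Rational.Unnormalised.Properties as ℚᵘ
open import Data.Sum.Base using (_⊎_; inj₁; inj₂; [_,_]′)
open import Data.Vec.Base as Vec
  using (Vec; []; _∷_; _∷ʳ_; map; init; tail; head; last; lookup; tabulate; replicate; initLast)
open import Data.Vec.Properties
  using (∷-injective; ∷-injectiveˡ; ∷-injectiveʳ; ≡-dec; init-∷ʳ; last-∷ʳ; lookup∘tabulate; tabulate∘lookup;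
         tabulate-∘; tabulate-cong; lookup-map)
open import Data.Vec.Relation.Unary.All as Allᵛ using (All; []; _∷_)
open import Function.Base using (_∘_)
open import Function.Bundles using (_⇔_; mk⇔; Equivalence)
open import Level using (0ℓ)
open import Relation.Binary.Construct.Closure.Equivalence as EqClosure using (EqClosure)
open import Relation.Binary.Construct.Closure.ReflexiveTransitive using (ε; _◅_; _◅◅_)
open import Relation.Binary.Construct.Closure.Symmetric using (fwd; bwd)
open import Relation.Binary.Definitions using (DecidableEquality; tri<; tri≈; tri>)
open import Relation.Binary.PropositionalEquality
open import Relation.Nullary using (¬_; Dec; yes; no; does; contradiction; _×-dec_; _⊎-dec_)
open import Relation.Nullary.Decidable using (map′)
open import Relation.Unary using (Pred; Decidable; _∈_)

open Equivalence using (to; from)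

-- Residues and pseudoweights

-- The construction differs for odd and even `k`, and for even `k` it rests on an arbitrary Eulerian
-- circuit over {0, k/2}. What the cases share: the self-negative residues form a group S, equal to
-- {0} or {0, k/2}, and every b_x is the translate by x of one sequence in S whose differences pass
-- once per period through all tuples over S. As F contains no self-negative tuple, an edge of Z
-- comes from b_x or from W according to whether its differences are self-negative. This dichotomy
-- settles the permutation of the edges, the exclusion of negatives and the count.
--
-- A circuit of W need not lift to a circuit of the same length: after a full turn of its
-- differences a tuple comes back translated by their sum. The orbits upstairs are therefore never
-- described; balance asks only for a bijection of the edges with matching endpoints.
--
-- The parity of n matters for the choice of circuits. For even n a circuit such as
-- [1, k-1, 1, k-1, ...] can be its own negative although its tuples are not, and nothing could be
-- chosen.

%-absorbˡ : ∀ a b n .{{_ : NonZero n}} → (a % n + b) % n ≡ (a + b) % n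
%-absorbˡ a b n = begin
  (a % n + b) % n         ≡⟨ %-distribˡ-+ (a % n) b n ⟩
  (a % n % n + b % n) % n ≡⟨ cong (λ c → (c + b % n) % n) (m%n%n≡m%n a n) ⟩
  (a % n + b % n) % n     ≡⟨ %-distribˡ-+ a b n ⟨
  (a + b) % n             ∎
  where open ≡-Reasoning

%-absorbʳ : ∀ a b n .{{_ : NonZero n}} → (a + b % n) % n ≡ (a + b) % n
%-absorbʳ a b n = begin
  (a + b % n) % n ≡⟨ cong (_% n) (+-comm a (b % n)) ⟩
  (b % n + a) % n ≡⟨ %-absorbˡ b a n ⟩
  (b + a) % n     ≡⟨ cong (_% n) (+-comm b a) ⟩
  (a + b) % n     ∎
  where open ≡-Reasoning

toℕ-mod : ∀ a n .{{_ : NonZero n}} → toℕ (a mod n) ≡ a % n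
toℕ-mod a n = toℕ-fromℕ< (m%n<n a n)

mod-cong : ∀ a b n .{{_ : NonZero n}} → a % n ≡ b % n → a mod n ≡ b mod n
mod-cong a b n eq = toℕ-injective (trans (toℕ-mod a n) (trans eq (sym (toℕ-mod b n))))

mod-toℕ : ∀ {n} .{{_ : NonZero n}} (x : Fin n) → toℕ x mod n ≡ x
mod-toℕ {n} x = toℕ-injective (trans (toℕ-mod (toℕ x) n) (m<n⇒m%n≡m (toℕ<n x)))

module Residues (l : ℕ) where

  private
    k : ℕ
    k = suc l

  ⊕-comm : ∀ (x y : Fin k) → x ⊕ y ≡ y ⊕ x
  ⊕-comm x y = cong (_mod k) (+-comm (toℕ x) (toℕ y))

  toℕ-⊕ : ∀ (x y : Fin k) → toℕ (x ⊕ y) ≡ (toℕ x + toℕ y) % k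
  toℕ-⊕ x y = toℕ-mod (toℕ x + toℕ y) k

  toℕ-⊝ : ∀ (x : Fin k) → toℕ (⊝ x) ≡ (k ∸ toℕ x) % k
  toℕ-⊝ x = toℕ-mod (k ∸ toℕ x) k

  ⊕-assoc : ∀ (x y z : Fin k) → (x ⊕ y) ⊕ z ≡ x ⊕ (y ⊕ z)
  ⊕-assoc x y z = mod-cong (toℕ (x ⊕ y) + toℕ z) (toℕ x + toℕ (y ⊕ z)) k (begin
    (toℕ (x ⊕ y) + toℕ z) % k          ≡⟨ cong (λ a → (a + toℕ z) % k) (toℕ-⊕ x y) ⟩
    ((toℕ x + toℕ y) % k + toℕ z) % k  ≡⟨ %-absorbˡ (toℕ x + toℕ y) (toℕ z) k ⟩
    (toℕ x + toℕ y + toℕ z) % k        ≡⟨ cong (_% k) (+-assoc (toℕ x) (toℕ y) (toℕ z)) ⟩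
    (toℕ x + (toℕ y + toℕ z)) % k      ≡⟨ %-absorbʳ (toℕ x) (toℕ y + toℕ z) k ⟨
    (toℕ x + (toℕ y + toℕ z) % k) % k  ≡⟨ cong (λ a → (toℕ x + a) % k) (toℕ-⊕ y z) ⟨
    (toℕ x + toℕ (y ⊕ z)) % k          ∎)
    where open ≡-Reasoning

  ⊕-identityˡ : ∀ (x : Fin k) → Fin.zero ⊕ x ≡ x
  ⊕-identityˡ = mod-toℕ

  ⊕-inverseʳ : ∀ (x : Fin k) → x ⊕ ⊝ x ≡ Fin.zero
  ⊕-inverseʳ x = toℕ-injective (begin
    toℕ (x ⊕ ⊝ x)                  ≡⟨ toℕ-⊕ x (⊝ x) ⟩
    (toℕ x + toℕ (⊝ x)) % k        ≡⟨ cong (λ a → (toℕ x + a) % k) (toℕ-⊝ x) ⟩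
    (toℕ x + (k ∸ toℕ x) % k) % k  ≡⟨ %-absorbʳ (toℕ x) (k ∸ toℕ x) k ⟩
    (toℕ x + (k ∸ toℕ x)) % k      ≡⟨ cong (_% k) (m+[n∸m]≡n (<⇒≤ (toℕ<n x))) ⟩
    k % k                          ≡⟨ n%n≡0 k ⟩
    0                              ∎)
    where open ≡-Reasoning

  residues : AbelianGroup 0ℓ 0ℓ
  residues = record
    { Carrier = Fin k ; _≈_ = _≡_ ; _∙_ = _⊕_ ; ε = Fin.zero ; _⁻¹ = ⊝_
    ; isAbelianGroup = record
      { isGroup = record
        { isMonoid = record
          { isSemigroup = record
            { isMagma = record { isEquivalence = isEquivalence ; ∙-cong = cong₂ _⊕_ }
            ; assoc = ⊕-assoc }
          ; identity = ⊕-identityˡ , λ x → trans (⊕-comm x Fin.zero) (⊕-identityˡ x) }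
        ; inverse = (λ x → trans (⊕-comm (⊝ x) x) (⊕-inverseʳ x)) , ⊕-inverseʳ
        ; ⁻¹-cong = cong ⊝_ }
      ; comm = ⊕-comm } }

  open AbelianGroup residues public using ()
    renaming (identityʳ to ⊕-identityʳ; inverseˡ to ⊕-inverseˡ)
  open AbelianGroupProperties residues public using ()
    renaming (⁻¹-involutive to ⊝-involutive; ∙-cancelʳ to ⊕-cancelʳ; ⁻¹-∙-comm to ⊝-⊕-comm
             ; ε⁻¹≈ε to ⊝-zero)

  ⊖-⊕ : ∀ (x y : Fin k) → (x ⊖ y) ⊕ y ≡ x
  ⊖-⊕ x y = trans (⊕-assoc x (⊝ y) y) (trans (cong (x ⊕_) (⊕-inverseˡ y)) (⊕-identityʳ x))

  ⊕-⊖ : ∀ (x y : Fin k) → (x ⊕ y) ⊖ y ≡ x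
  ⊕-⊖ x y = trans (⊕-assoc x y (⊝ y)) (trans (cong (x ⊕_) (⊕-inverseʳ y)) (⊕-identityʳ x))

  ⊕-⊖ˡ : ∀ (x y : Fin k) → (x ⊕ y) ⊖ x ≡ y
  ⊕-⊖ˡ x y = trans (cong (_⊖ x) (⊕-comm x y)) (⊕-⊖ y x)

  ⊖-⊖ : ∀ (x y : Fin k) → x ⊖ (x ⊖ y) ≡ y
  ⊖-⊖ x y = ⊕-cancelʳ (x ⊖ y) _ _ (trans (⊖-⊕ x (x ⊖ y)) (sym (trans (⊕-comm y (x ⊖ y)) (⊖-⊕ x y))))

  ⊝-⊖ : ∀ (x y : Fin k) → ⊝ (x ⊖ y) ≡ (⊝ x) ⊖ (⊝ y)
  ⊝-⊖ x y = sym (⊝-⊕-comm x (⊝ y))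

  ⊖-translate : ∀ (z x y : Fin k) → (z ⊕ x) ⊖ (z ⊕ y) ≡ x ⊖ y
  ⊖-translate z x y = ⊕-cancelʳ (z ⊕ y) _ _ (begin
    ((z ⊕ x) ⊖ (z ⊕ y)) ⊕ (z ⊕ y) ≡⟨ ⊖-⊕ (z ⊕ x) (z ⊕ y) ⟩
    z ⊕ x                         ≡⟨ cong (z ⊕_) (⊖-⊕ x y) ⟨
    z ⊕ ((x ⊖ y) ⊕ y)             ≡⟨ cong (z ⊕_) (⊕-comm (x ⊖ y) y) ⟩
    z ⊕ (y ⊕ (x ⊖ y))             ≡⟨ ⊕-assoc z y (x ⊖ y) ⟨
    (z ⊕ y) ⊕ (x ⊖ y)             ≡⟨ ⊕-comm (z ⊕ y) (x ⊖ y) ⟩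
    (x ⊖ y) ⊕ (z ⊕ y)             ∎)
    where open ≡-Reasoning

  ⊝-suc : ∀ (u : Fin l) → toℕ (⊝ (Fin.suc u)) ≡ l ∸ toℕ u
  ⊝-suc u = trans (toℕ-⊝ (Fin.suc u)) (m≤n⇒m%n≡m (m∸n≤m l (toℕ u)))

  -- Twice the summand f of the pseudoweight, a natural number.
  doubleWeight : Fin k → ℕ
  doubleWeight Fin.zero      = k
  doubleWeight u@(Fin.suc _) = 2 * toℕ u

  doubleWeight-pos : ∀ u → 0 < toℕ u → doubleWeight u ≡ 2 * toℕ u
  doubleWeight-pos (Fin.suc u) _ = refl

  -- This is what the value k/2 of `f` at 0 is for: f(u) + f(-u) = k without exception, so negation
  -- reflects the pseudoweights of n-tuples about nk/2.
  doubleWeight-⊝ : ∀ u → doubleWeight (⊝ u) + doubleWeight u ≡ 2 * k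
  doubleWeight-⊝ Fin.zero = trans (cong (λ v → doubleWeight v + k) ⊝-zero) (cong (k +_) (sym (+-identityʳ k)))
  doubleWeight-⊝ (Fin.suc u) = begin
    doubleWeight (⊝ (Fin.suc u)) + 2 * suc (toℕ u) ≡⟨ cong (_+ 2 * suc (toℕ u)) (doubleWeight-pos (⊝ (Fin.suc u)) pos) ⟩
    2 * toℕ (⊝ (Fin.suc u)) + 2 * suc (toℕ u)      ≡⟨ *-distribˡ-+ 2 (toℕ (⊝ (Fin.suc u))) (suc (toℕ u)) ⟨
    2 * (toℕ (⊝ (Fin.suc u)) + suc (toℕ u))        ≡⟨ cong (λ a → 2 * (a + suc (toℕ u))) (⊝-suc u) ⟩
    2 * (l ∸ toℕ u + suc (toℕ u))                  ≡⟨ cong (2 *_) (+-suc (l ∸ toℕ u) (toℕ u)) ⟩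
    2 * suc (l ∸ toℕ u + toℕ u)                    ≡⟨ cong (λ a → 2 * suc a) (m∸n+n≡m (<⇒≤ (toℕ<n u))) ⟩
    2 * k                                          ∎
    where
    open ≡-Reasoning
    pos : 0 < toℕ (⊝ (Fin.suc u))
    pos = subst (0 <_) (sym (⊝-suc u)) (m<n⇒0<n∸m (toℕ<n u))

  -- By `doubleWeight-⊝` the negative has doubled weight k as well, and `doubleWeight` is injective
  -- on nonzero residues.
  doubleWeight≡k⇒selfNegative : ∀ u → doubleWeight u ≡ k → ⊝ u ≡ u
  doubleWeight≡k⇒selfNegative Fin.zero      eq = ⊝-zero
  doubleWeight≡k⇒selfNegative (Fin.suc u) eq = toℕ-injective (*-cancelˡ-≡ _ (suc (toℕ u)) 2
    (trans (sym (doubleWeight-pos (⊝ (Fin.suc u)) pos))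
      (trans (+-cancelʳ-≡ k _ _ (trans (cong (doubleWeight (⊝ (Fin.suc u)) +_) (sym eq)) (trans (doubleWeight-⊝
          (Fin.suc u)) (cong (k +_) (+-identityʳ k))))) (sym eq))))
    where
    pos : 0 < toℕ (⊝ (Fin.suc u))
    pos = subst (0 <_) (sym (⊝-suc u)) (m<n⇒0<n∸m (toℕ<n u))

  selfNegative⇒doubleWeight≡k : ∀ u → ⊝ u ≡ u → doubleWeight u ≡ k
  selfNegative⇒doubleWeight≡k u eq = *-cancelˡ-≡ _ _ 2 (trans (trans (cong (doubleWeight u +_) (+-identityʳ _)) (cong
      (λ v → doubleWeight v + doubleWeight u) (sym eq))) (doubleWeight-⊝ u))

  2≤doubleWeight : 1 < k → ∀ u → 2 ≤ doubleWeight u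
  2≤doubleWeight 1<k Fin.zero    = 1<k
  2≤doubleWeight 1<k (Fin.suc u) = *-monoʳ-≤ 2 (s≤s (z≤n {toℕ u}))

  weight : ∀ {n} → Vec (Fin k) n → ℕ
  weight []      = 0
  weight (x ∷ v) = doubleWeight x + weight v

  weight-∷ʳ : ∀ {n} (v : Vec (Fin k) n) x → weight (v ∷ʳ x) ≡ doubleWeight x + weight v
  weight-∷ʳ []      x = refl
  weight-∷ʳ (y ∷ v) x = trans (cong (doubleWeight y +_) (weight-∷ʳ v x)) (swap (doubleWeight y) (doubleWeight x) (weight v))
    where
    swap : ∀ a b c → a + (b + c) ≡ b + (a + c)
    swap = solve-∀

  weight-neg : ∀ {n} (v : Vec (Fin k) n) → weight (neg v) + weight v ≡ 2 * (n * k)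
  weight-neg []                = refl
  weight-neg {suc n} (x ∷ v) = begin
    doubleWeight (⊝ x) + weight (neg v) + (doubleWeight x + weight v) ≡⟨ swap (doubleWeight (⊝ x)) _ _ _ ⟩
    doubleWeight (⊝ x) + doubleWeight x + (weight (neg v) + weight v) ≡⟨ cong₂ _+_ (doubleWeight-⊝ x) (weight-neg v) ⟩
    2 * k + 2 * (n * k)                                               ≡⟨ *-distribˡ-+ 2 k (n * k) ⟨
    2 * (k + n * k)                                                   ∎
    where
    open ≡-Reasoning
    swap : ∀ a b c d → a + b + (c + d) ≡ a + c + (b + d)
    swap = solve-∀

  selfNegative⇒weight : ∀ {n} (v : Vec (Fin k) n) → neg v ≡ v → weight v ≡ n * k
  selfNegative⇒weight {n} v eq = *-cancelˡ-≡ _ _ 2 (trans (trans (cong (weight v +_) (+-identityʳ _)) (cong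
      (λ u → weight u + weight v) (sym eq))) (weight-neg v))

  half : ℕ → ℚ
  half a = ℤ.+ a ℚ./ 2

  -- `half a` is kept in lowest terms and so depends on the parity of `a`. The unreduced fraction
  -- has denominator 2 throughout (`mkℚᵘ` stores it minus one), which turns sums and comparisons
  -- into cross-multiplication of naturals.
  toℚᵘ-half : ∀ a → toℚᵘ (half a) ≃ mkℚᵘ (ℤ.+ a) 1
  toℚᵘ-half a = ℚ.toℚᵘ-fromℚᵘ (mkℚᵘ (ℤ.+ a) 1)

  half-+ : ∀ a b → half a ℚ.+ half b ≡ half (a + b)
  half-+ a b = ℚ.toℚᵘ-injective (begin
    toℚᵘ (half a ℚ.+ half b)                      ≈⟨ ℚ.toℚᵘ-homo-+ (half a) (half b) ⟩
    toℚᵘ (half a) ℚᵘ.+ toℚᵘ (half b)              ≈⟨ ℚᵘ.+-cong (toℚᵘ-half a) (toℚᵘ-half b) ⟩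
    mkℚᵘ (ℤ.+ a) 1 ℚᵘ.+ mkℚᵘ (ℤ.+ b) 1            ≈⟨ *≡* numerators ⟩
    mkℚᵘ (ℤ.+ (a + b)) 1                          ≈⟨ toℚᵘ-half (a + b) ⟨
    toℚᵘ (half (a + b))                           ∎)
    where
    -- The factor 4 is the denominator of the unreduced sum.
    distrib : ∀ a b → (a * 2 + b * 2) * 2 ≡ (a + b) * 4
    distrib = solve-∀
    numerators : (ℤ.+ a ℤ.* ℤ.+ 2 ℤ.+ ℤ.+ b ℤ.* ℤ.+ 2) ℤ.* ℤ.+ 2 ≡ ℤ.+ (a + b) ℤ.* ℤ.+ 4
    numerators = begin
        (ℤ.+ a ℤ.* ℤ.+ 2 ℤ.+ ℤ.+ b ℤ.* ℤ.+ 2) ℤ.* ℤ.+ 2 ≡⟨ cong₂ (λ p q → (p ℤ.+ q) ℤ.* ℤ.+ 2) (ℤ.pos-* a 2) (ℤ.pos-* b 2) ⟨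
        ℤ.+ (a * 2 + b * 2) ℤ.* ℤ.+ 2                   ≡⟨ ℤ.pos-* (a * 2 + b * 2) 2 ⟨
        ℤ.+ ((a * 2 + b * 2) * 2)                       ≡⟨ cong ℤ.+_ (distrib a b) ⟩
        ℤ.+ ((a + b) * 4)                               ≡⟨ ℤ.pos-* (a + b) 4 ⟩
        ℤ.+ (a + b) ℤ.* ℤ.+ 4                           ∎
      where open ≡-Reasoning
    open ℚᵘ.≃-Reasoning

  half-injective : ∀ {a b} → half a ≡ half b → a ≡ b
  half-injective {a} {b} eq
    with ℚᵘ.≃-trans (ℚᵘ.≃-sym (toℚᵘ-half a)) (ℚᵘ.≃-trans (ℚ.toℚᵘ-cong eq) (toℚᵘ-half b))
  ... | *≡* p = *-cancelʳ-≡ a b 2 (ℤ.+-injective (trans (ℤ.pos-* a 2) (trans p (sym (ℤ.pos-* b 2)))))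

  half-cancel-< : ∀ {a b} → half a ℚ.< half b → a < b
  half-cancel-< {a} {b} lt
    with ℚᵘ.<-respˡ-≃ (toℚᵘ-half a) (ℚᵘ.<-respʳ-≃ (toℚᵘ-half b) (ℚ.toℚᵘ-mono-< lt))
  ... | *<* p = *-cancelʳ-< 2 a b (ℤ.drop‿+<+ (subst₂ ℤ._<_ (sym (ℤ.pos-* a 2)) (sym (ℤ.pos-* b 2)) p))

  half-mono-< : ∀ {a b} → a < b → half a ℚ.< half b
  half-mono-< {a} {b} lt = ℚ.toℚᵘ-cancel-< (ℚᵘ.<-respˡ-≃ (ℚᵘ.≃-sym (toℚᵘ-half a)) (ℚᵘ.<-respʳ-≃ (ℚᵘ.≃-sym (toℚᵘ-half b))
    (*<* (subst₂ ℤ._<_ (ℤ.pos-* a 2) (ℤ.pos-* b 2) (ℤ.+<+ (*-monoˡ-< 2 lt))))))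

  f≡half : (u : Fin k) → f u ≡ half (doubleWeight u)
  f≡half Fin.zero    = refl
  f≡half (Fin.suc u) = ℚ.fromℚᵘ-cong {mkℚᵘ (ℤ.+ suc (toℕ u)) 0} {mkℚᵘ (ℤ.+ (2 * suc (toℕ u))) 1}
    (*≡* (trans (sym (ℤ.pos-* (suc (toℕ u)) 2)) (trans (cong ℤ.+_ (double (suc (toℕ u)))) (ℤ.pos-* (2 * suc (toℕ u)) 1))))
    where
    double : ∀ a → a * 2 ≡ 2 * a * 1
    double = solve-∀

  w*≡half : ∀ {n} (v : Tuple k n) → w* v ≡ half (weight v)
  w*≡half []      = refl
  w*≡half (x ∷ v) = trans (cong₂ ℚ._+_ (f≡half x) (w*≡half v)) (half-+ (doubleWeight x) (weight v))

  E*⇒weight : ∀ {n} {v : Tuple k n} → E* k n v → weight v < n * k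
  E*⇒weight {v = v} lt = half-cancel-< (subst (ℚ._< _) (w*≡half v) lt)

  weight⇒E* : ∀ {n} {v : Tuple k n} → weight v < n * k → E* k n v
  weight⇒E* {v = v} lt = subst (ℚ._< _) (sym (w*≡half v)) (half-mono-< lt)

-- Windows, rotations and differences

module _ {A : Set} where

  window-cong : ∀ r (s t : ℕ → A) i j → (∀ x → s (i + x) ≡ t (j + x)) → window r s i ≡ window r t j
  window-cong r s t i j eq = tabulate-cong (eq ∘ toℕ)

  window-suc : ∀ r (s : ℕ → A) i → window (suc r) s i ≡ s i ∷ window r s (suc i)
  window-suc r s i = cong₂ _∷_ (cong s (+-identityʳ i)) (tabulate-cong λ j → cong s (+-suc i (toℕ j)))

  window-∷ʳ : ∀ r (s : ℕ → A) i → window (suc r) s i ≡ window r s i ∷ʳ s (i + r)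
  window-∷ʳ zero    s i = refl
  window-∷ʳ (suc r) s i = begin
    window (suc (suc r)) s i                      ≡⟨ window-suc (suc r) s i ⟩
    s i ∷ window (suc r) s (suc i)                ≡⟨ cong (s i ∷_) (window-∷ʳ r s (suc i)) ⟩
    (s i ∷ window r s (suc i)) ∷ʳ s (suc (i + r)) ≡⟨ cong₂ _∷ʳ_ (window-suc r s i) (cong s (+-suc i r)) ⟨
    window (suc r) s i ∷ʳ s (i + suc r)           ∎
    where open ≡-Reasoning

  head-window : ∀ r (s : ℕ → A) i → head (window (suc r) s i) ≡ s i
  head-window r s i = cong s (+-identityʳ i)

  tail-window : ∀ r (s : ℕ → A) i → tail (window (suc r) s i) ≡ window r s (suc i)
  tail-window r s i = cong tail (window-suc r s i)

  init-window : ∀ r (s : ℕ → A) i → init (window (suc r) s i) ≡ window r s i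
  init-window r s i = trans (cong init (window-∷ʳ r s i)) (init-∷ʳ (s (i + r)) (window r s i))

  init-∷ʳ-last : ∀ {r} (v : Vec A (suc r)) → v ≡ init v ∷ʳ last v
  init-∷ʳ-last v = proj₂ (proj₂ (initLast v))

  head∷tail : ∀ {r} (v : Vec A (suc r)) → head v ∷ tail v ≡ v
  head∷tail (x ∷ v) = refl

  last-∷ : ∀ {r} x (v : Vec A (suc r)) → last (x ∷ v) ≡ last v
  last-∷ x (y ∷ v) = refl

  init-tail : ∀ {r} (v : Vec A (suc (suc r))) → init (tail v) ≡ tail (init v)
  init-tail (x ∷ y ∷ v) = refl

  head-init : ∀ {r} (v : Vec A (suc (suc r))) → head (init v) ≡ head v
  head-init (x ∷ y ∷ v) = refl

  -- A walk in a de Bruijn graph is spelt by the first entries of its edges. Dropping last entries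
  -- leaves a walk of tuples one shorter with the same first entries, hence the induction on `r`.
  window-walk : ∀ r (g : ℕ → Vec A (suc r)) → (∀ i → tail (g i) ≡ init (g (suc i))) →
                ∀ i → window (suc r) (head ∘ g) i ≡ g i
  window-walk zero    g walk i with g (i + 0) | cong g (+-identityʳ i)
  ... | x ∷ [] | eq = eq
  window-walk (suc r) g walk i = begin
    window (suc (suc r)) (head ∘ g) i                   ≡⟨ window-suc (suc r) (head ∘ g) i ⟩
    head (g i) ∷ window (suc r) (head ∘ g) (suc i)      ≡⟨ cong (head (g i) ∷_) (window-cong (suc r) (head ∘ g)
        (head ∘ init ∘ g) (suc i) (suc i) λ x → sym (head-init (g (suc i + x)))) ⟩
    head (g i) ∷ window (suc r) (head ∘ init ∘ g) (suc i) ≡⟨ cong (head (g i) ∷_) (window-walk r (init ∘ g) walk′ (suc i)) ⟩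
    head (g i) ∷ init (g (suc i))                       ≡⟨ cong (head (g i) ∷_) (walk i) ⟨
    head (g i) ∷ tail (g i)                             ≡⟨ head∷tail (g i) ⟩
    g i                                                 ∎
    where
    open ≡-Reasoning
    walk′ : ∀ i → tail (init (g i)) ≡ init (init (g (suc i)))
    walk′ i = trans (sym (init-tail (g i))) (cong init (walk i))

  cyclic-cong : ∀ {m} .{{_ : NonZero m}} (c : Vec A m) i j → i % m ≡ j % m → cyclic c i ≡ cyclic c j
  cyclic-cong {m} c i j eq = cong (lookup c) (mod-cong i j m eq)

  cyclic-tabulate : ∀ {m} .{{_ : NonZero m}} (s : ℕ → A) i → cyclic (tabulate {n = m} (s ∘ toℕ)) i ≡ s (i % m)
  cyclic-tabulate {m} s i = trans (lookup∘tabulate (s ∘ toℕ) (i mod m)) (cong s (toℕ-mod i m))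

  module _ {m : ℕ} where

    -- In this form `b ∈ [ a ]` unfolds to the existence of an `i` with `rotate i a ≡ b`.
    rotate : ℕ → Vec A (suc m) → Vec A (suc m)
    rotate i a = window (suc m) (cyclic a) i

    cyclic-rotate : ∀ i a j → cyclic (rotate i a) j ≡ cyclic a (i + j)
    cyclic-rotate i a j = begin
      lookup (rotate i a) (j mod suc m)   ≡⟨ lookup∘tabulate (λ x → cyclic a (i + toℕ x)) (j mod suc m) ⟩
      cyclic a (i + toℕ (j mod suc m))    ≡⟨ cong (λ x → cyclic a (i + x)) (toℕ-mod j (suc m)) ⟩
      cyclic a (i + j % suc m)            ≡⟨ cyclic-cong a (i + j % suc m) (i + j) (%-absorbʳ i j (suc m)) ⟩
      cyclic a (i + j)                    ∎
      where open ≡-Reasoning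

    rotate-rotate : ∀ i j a → rotate j (rotate i a) ≡ rotate (i + j) a
    rotate-rotate i j a = window-cong (suc m) (cyclic (rotate i a)) (cyclic a) j (i + j) λ x →
      trans (cyclic-rotate i a (j + x)) (cong (cyclic a) (sym (+-assoc i j x)))

    rotate-cong : ∀ i j a → i % suc m ≡ j % suc m → rotate i a ≡ rotate j a
    rotate-cong i j a eq = window-cong (suc m) (cyclic a) (cyclic a) i j λ x → cyclic-cong a (i + x) (j + x) (begin
      (i + x) % suc m         ≡⟨ %-absorbˡ i x (suc m) ⟨
      (i % suc m + x) % suc m ≡⟨ cong (λ y → (y + x) % suc m) eq ⟩
      (j % suc m + x) % suc m ≡⟨ %-absorbˡ j x (suc m) ⟩
      (j + x) % suc m         ∎)
      where open ≡-Reasoning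

    rotate-zero : ∀ a → rotate 0 a ≡ a
    rotate-zero a = trans (tabulate-cong λ j → cong (lookup a) (mod-toℕ j)) (tabulate∘lookup a)

    rotate-multiple : ∀ q a → rotate (q * suc m) a ≡ a
    rotate-multiple q a = trans (rotate-cong (q * suc m) 0 a (m*n%n≡0 q (suc m))) (rotate-zero a)

    rotate-one : ∀ x (v : Vec A m) → rotate 1 (x ∷ v) ≡ v ∷ʳ x
    rotate-one x v = begin
      rotate 1 (x ∷ v)                             ≡⟨ tail-window (suc m) s 0 ⟨
      tail (window (suc (suc m)) s 0)              ≡⟨ cong tail (window-∷ʳ (suc m) s 0) ⟩
      tail (rotate 0 (x ∷ v) ∷ʳ s (suc m))         ≡⟨ cong₂ (λ a y → tail (a ∷ʳ y)) (rotate-zero (x ∷ v)) (cyclic-cong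
          (x ∷ v) (suc m) 0 (n%n≡0 (suc m))) ⟩
      v ∷ʳ x                                       ∎
      where
      open ≡-Reasoning
      s : ℕ → A
      s = cyclic (x ∷ v)

    rotate-last : ∀ x (v : Vec A m) → rotate m (v ∷ʳ x) ≡ x ∷ v
    rotate-last x v = begin
      rotate m (v ∷ʳ x)           ≡⟨ cong (rotate m) (rotate-one x v) ⟨
      rotate m (rotate 1 (x ∷ v)) ≡⟨ rotate-rotate 1 m (x ∷ v) ⟩
      rotate (suc m) (x ∷ v)      ≡⟨ rotate-cong (suc m) 0 (x ∷ v) (n%n≡0 (suc m)) ⟩
      rotate 0 (x ∷ v)            ≡⟨ rotate-zero (x ∷ v) ⟩
      x ∷ v                       ∎
      where open ≡-Reasoning

_≟ᵗ_ : ∀ {k r} → DecidableEquality (Tuple k r)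
_≟ᵗ_ = ≡-dec Fin._≟_

neg-window : ∀ {k} r (s : ℕ → Fin k) i → neg (window r s i) ≡ window r (⊝_ ∘ s) i
neg-window r s i = sym (tabulate-∘ ⊝_ λ j → s (i + toℕ j))

neg-rotate : ∀ {k m} i (a : Tuple k (suc m)) → neg (rotate i a) ≡ rotate i (neg a)
neg-rotate {m = m} i a = trans (neg-window (suc m) (cyclic a) i)
  (window-cong (suc m) (⊝_ ∘ cyclic a) (cyclic (neg a)) i i λ x → sym (lookup-map ((i + x) mod suc m) ⊝_ a))

module Differences (l : ℕ) where

  open Residues l

  private
    k : ℕ
    k = suc l

  neg-involutive : ∀ {r} (v : Tuple k r) → neg (neg v) ≡ v
  neg-involutive []      = refl
  neg-involutive (x ∷ v) = cong₂ _∷_ (⊝-involutive x) (neg-involutive v)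

  D-∷ʳ : ∀ {r} (v : Tuple k (suc r)) z → D (v ∷ʳ z) ≡ D v ∷ʳ (z ⊖ last v)
  D-∷ʳ (x ∷ [])    z = refl
  D-∷ʳ (x ∷ y ∷ v) z = cong ((y ⊖ x) ∷_) (D-∷ʳ (y ∷ v) z)

  D-∷ : ∀ {r} x (v : Tuple k (suc r)) → D (x ∷ v) ≡ (head v ⊖ x) ∷ D v
  D-∷ x (y ∷ v) = refl

  D-neg : ∀ {r} (v : Tuple k (suc r)) → D (neg v) ≡ neg (D v)
  D-neg (x ∷ [])    = refl
  D-neg (x ∷ y ∷ v) = cong₂ _∷_ (sym (⊝-⊖ y x)) (D-neg (y ∷ v))

  D-translate : ∀ {r} z (v : Tuple k (suc r)) → D (map (z ⊕_) v) ≡ D v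
  D-translate z (x ∷ [])    = refl
  D-translate z (x ∷ y ∷ v) = cong₂ _∷_ (⊖-translate z y x) (D-translate z (y ∷ v))

  -- Differences determine a tuple up to translation, and the first entry fixes the translation.
  D-injective : ∀ {r} (u v : Tuple k (suc r)) → head u ≡ head v → D u ≡ D v → u ≡ v
  D-injective (x ∷ [])     (x ∷ [])     refl _  = refl
  D-injective (x ∷ y ∷ u) (x ∷ z ∷ v) refl eq =
    cong (x ∷_) (D-injective (y ∷ u) (z ∷ v) (⊕-cancelʳ (⊝ x) y z (∷-injectiveˡ eq)) (∷-injectiveʳ eq))

  map-window : ∀ r z (s : ℕ → Fin k) i → window r (λ x → z ⊕ s x) i ≡ map (z ⊕_) (window r s i)
  map-window r z s i = tabulate-∘ (z ⊕_) λ j → s (i + toℕ j)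

  D-window : ∀ r (s : ℕ → Fin k) i → D (window (suc r) s i) ≡ window r (λ x → s (suc x) ⊖ s x) i
  D-window zero    s i = refl
  D-window (suc r) s i = begin
    D (window (suc (suc r)) s i)                           ≡⟨ cong D (window-suc (suc r) s i) ⟩
    D (s i ∷ window (suc r) s (suc i))                     ≡⟨ D-∷ (s i) (window (suc r) s (suc i)) ⟩
    (head (window (suc r) s (suc i)) ⊖ s i) ∷ D (window (suc r) s (suc i)) ≡⟨ cong₂ (λ x v → (x ⊖ s i) ∷ v)
        (head-window r s (suc i)) (D-window r s (suc i)) ⟩
    (s (suc i) ⊖ s i) ∷ window r (λ x → s (suc x) ⊖ s x) (suc i) ≡⟨ window-suc r (λ x → s (suc x) ⊖ s x) i ⟨
    window (suc r) (λ x → s (suc x) ⊖ s x) i               ∎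
    where open ≡-Reasoning

-- Eulerian circuits

module Euler {A V : Set} (_≟_ : DecidableEquality V) (src tgt : A → V) where

  data Path : V → List A → V → Set where
    []  : ∀ {v} → Path v [] v
    _∷_ : ∀ e {es v} → Path (tgt e) es v → Path (src e) (e ∷ es) v

  _++ᵖ_ : ∀ {u v w es es′} → Path u es v → Path v es′ w → Path u (es ++ es′) w
  []      ++ᵖ q = q
  (e ∷ p) ++ᵖ q = e ∷ (p ++ᵖ q)

  splitPath : ∀ {u w} es {es′} → Path u (es ++ es′) w → ∃ λ v → Path u es v × Path v es′ w
  splitPath []       p       = _ , [] , p
  splitPath (e ∷ es) (e ∷ p) = let v , q , r = splitPath es p in v , e ∷ q , r

  Closed : List A → Set
  Closed es = ∃ λ v → Path v es v

  rotateClosed : ∀ es es′ → Closed (es ++ es′) → Closed (es′ ++ es)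
  rotateClosed es es′ (v , p) = let w , q , r = splitPath es p in w , r ++ᵖ q

  fromEdge : ∀ {e es} → Closed (e ∷ es) → Path (src e) (e ∷ es) (src e)
  fromEdge (_ , e ∷ p) = e ∷ p

  δ : V → V → ℕ
  δ u v = if does (u ≟ v) then 1 else 0

  δ-refl : ∀ v → δ v v ≡ 1
  δ-refl v with v ≟ v
  ... | yes _  = refl
  ... | no v≢v = contradiction refl v≢v

  δ-≢ : ∀ {u v} → u ≢ v → δ u v ≡ 0
  δ-≢ {u} {v} u≢v with u ≟ v
  ... | yes u≡v = contradiction u≡v u≢v
  ... | no _    = refl

  degree : (A → V) → V → List A → ℕ
  degree f v es = length (filter (λ e → f e ≟ v) es)

  Balanced : List A → Set
  Balanced es = ∀ v → degree src v es ≡ degree tgt v es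

  degree-∷ : ∀ f v e es → degree f v (e ∷ es) ≡ δ (f e) v + degree f v es
  degree-∷ f v e es with does (f e ≟ v)
  ... | true  = refl
  ... | false = refl

  degree-↭ : ∀ f v {es es′} → es ↭ es′ → degree f v es ≡ degree f v es′
  degree-↭ f v = ↭-length ∘ filter-↭ (λ e → f e ≟ v)

  degree-suc : ∀ f v es {d} → degree f v es ≡ suc d → ∃ λ e → f e ≡ v × ∃ λ es′ → es ↭ e ∷ es′
  degree-suc f v (e ∷ es) eq with f e ≟ v
  ... | yes fe≡v = e , fe≡v , es , ↭-refl
  ... | no _     = let e′ , p , es′ , q = degree-suc f v es eq in
    e′ , p , e ∷ es′ , ↭-trans (prep e q) (_↭_.swap e e′ ↭-refl)

  -- In a graph that is balanced but for a missing edge from u to v, a walk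
  -- from v can only get stuck at u.
  peel : ∀ n u v es → length es ≡ n → (∀ w → degree src w es + δ u w ≡ degree tgt w es + δ v w) →
         ∃₂ λ es₁ es₂ → Path v es₁ u × es ↭ es₁ ++ es₂ × Balanced es₂
  peel n u v es len excess with v ≟ u
  peel n u v es len excess | yes refl = [] , es , [] , ↭-refl , λ w → +-cancelʳ-≡ (δ u w) _ _ (excess w)
  ... | no v≢u with degree-suc src v es out
    where
    out : degree src v es ≡ suc (degree tgt v es)
    out = begin
      degree src v es             ≡⟨ +-identityʳ _ ⟨
      degree src v es + 0         ≡⟨ cong (degree src v es +_) (δ-≢ (v≢u ∘ sym)) ⟨
      degree src v es + δ u v     ≡⟨ excess v ⟩
      degree tgt v es + δ v v     ≡⟨ cong (degree tgt v es +_) (δ-refl v) ⟩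
      degree tgt v es + 1         ≡⟨ +-comm _ 1 ⟩
      suc (degree tgt v es)       ∎
      where open ≡-Reasoning
  peel zero u v es len excess | no v≢u | e , refl , es′ , es↭ =
    contradiction (trans (sym len) (↭-length es↭)) λ ()
  peel (suc n) u v es len excess | no v≢u | e , refl , es′ , es↭ =
    let es₁ , es₂ , p , es′↭ , bal = peel n u (tgt e) es′ len′ excess′ in
    e ∷ es₁ , es₂ , e ∷ p , ↭-trans es↭ (prep e es′↭) , bal
    where
    len′ : length es′ ≡ n
    len′ = suc-injective (trans (sym (↭-length es↭)) len)
    excess′ : ∀ w → degree src w es′ + δ u w ≡ degree tgt w es′ + δ (tgt e) w
    excess′ w = +-cancelˡ-≡ (δ (src e) w) _ _ (begin
      δ (src e) w + (degree src w es′ + δ u w)       ≡⟨ +-assoc (δ (src e) w) _ _ ⟨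
      δ (src e) w + degree src w es′ + δ u w         ≡⟨ cong (_+ δ u w) (degree-∷ src w e es′) ⟨
      degree src w (e ∷ es′) + δ u w                 ≡⟨ cong (_+ δ u w) (degree-↭ src w es↭) ⟨
      degree src w es + δ u w                        ≡⟨ excess w ⟩
      degree tgt w es + δ v w                        ≡⟨ cong (_+ δ v w) (degree-↭ tgt w es↭) ⟩
      degree tgt w (e ∷ es′) + δ v w                 ≡⟨ cong (_+ δ v w) (degree-∷ tgt w e es′) ⟩
      δ (tgt e) w + degree tgt w es′ + δ v w         ≡⟨ rearrange (δ (tgt e) w) (degree tgt w es′) (δ v w) ⟩
      δ (src e) w + (degree tgt w es′ + δ (tgt e) w) ∎)
      where
      open ≡-Reasoning
      rearrange : ∀ a b c → a + b + c ≡ c + (b + a)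
      rearrange = solve-∀

  -- Without `e` the list is balanced but for a missing edge from `src e` to `tgt e`, so `peel`
  -- walks from `tgt e` back to `src e`, and `e` closes that walk.
  peelClosed : ∀ e es → Balanced (e ∷ es) →
               ∃₂ λ es₁ es₂ → Closed (e ∷ es₁) × es ↭ es₁ ++ es₂ × Balanced es₂
  peelClosed e es bal =
    let es₁ , es₂ , p , es↭ , bal′ = peel (length es) (src e) (tgt e) es refl excess in
    es₁ , es₂ , (src e , e ∷ p) , es↭ , bal′
    where
    excess : ∀ w → degree src w es + δ (src e) w ≡ degree tgt w es + δ (tgt e) w
    excess w = begin
      degree src w es + δ (src e) w ≡⟨ +-comm _ (δ (src e) w) ⟩
      δ (src e) w + degree src w es ≡⟨ degree-∷ src w e es ⟨
      degree src w (e ∷ es)         ≡⟨ bal w ⟩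
      degree tgt w (e ∷ es)         ≡⟨ degree-∷ tgt w e es ⟩
      δ (tgt e) w + degree tgt w es ≡⟨ +-comm (δ (tgt e) w) _ ⟩
      degree tgt w es + δ (tgt e) w ∎
      where open ≡-Reasoning

  -- The bound `n` drives the recursion: what is left after removing a circuit is known only up to
  -- permutation and is no sublist of `es`.
  decompose : ∀ n es → length es ≤ n → Balanced es → ∃ λ ess → Allˡ.All Closed ess × es ↭ concat ess
  decompose n       []       _         bal = [] , [] , ↭-refl
  decompose (suc n) (e ∷ es) (s≤s len) bal =
    let es₁ , es₂ , c , es↭ , bal′ = peelClosed e es bal
        ess , cs , es₂↭ = decompose n es₂ (shorter es₁ es₂ es↭) bal′ in
    (e ∷ es₁) ∷ ess , c ∷ cs , prep e (↭-trans es↭ (++⁺ˡ es₁ es₂↭))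
    where
    shorter : ∀ es₁ es₂ → es ↭ es₁ ++ es₂ → length es₂ ≤ n
    shorter es₁ es₂ es↭ = ≤-trans (≤-trans (m≤n+m (length es₂) (length es₁))
      (≤-reflexive (sym (trans (↭-length es↭) (Listₚ.length-++ es₁))))) len

  Edge : List A → V → V → Set
  Edge es u v = ∃ λ e → e ∈ˡ es × src e ≡ u × tgt e ≡ v

  Connected : List A → Set
  Connected es = ∀ {e e′} → e ∈ˡ es → e′ ∈ˡ es → EqClosure (Edge es) (src e) (src e′)

  Visits : List A → V → Set
  Visits es v = Any (λ e → src e ≡ v) es

  startsAt : ∀ {u es v} → Path u es v → u ≡ v ⊎ Visits es u
  startsAt []      = inj₁ refl
  startsAt (e ∷ p) = inj₂ (here refl)

  -- Turn the circuit so that `e` comes first. Either nothing follows and `e` is a loop, or the next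
  -- edge starts at `tgt e`. This is why `Visits` may look at sources alone.
  visitsTarget : ∀ {e es} → Closed es → e ∈ˡ es → Visits es (tgt e)
  visitsTarget {e} c e∈es with ∈-∃++ e∈es
  ... | es₁ , es₂ , refl with fromEdge (rotateClosed es₁ (e ∷ es₂) c)
  ... | e ∷ p with startsAt p
  ... | inj₁ eq    = lose e∈es (sym eq)
  ... | inj₂ visit with find visit
  ... | g , g∈ , eq = lose (reinsert (∈-++⁻ es₂ g∈)) eq
    where
    reinsert : g ∈ˡ es₂ ⊎ g ∈ˡ es₁ → g ∈ˡ es₁ ++ e ∷ es₂
    reinsert (inj₁ g∈₂) = ∈-++⁺ʳ es₁ (there g∈₂)
    reinsert (inj₂ g∈₁) = ∈-++⁺ˡ g∈₁

  Meets : List A → List A → Set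
  Meets es es′ = Any (λ e → Visits es (src e)) es′

  -- Both circuits are turned so as to start at the common vertex and are then run one after the
  -- other.
  merge : ∀ es es′ → Closed es → Closed es′ → Meets es es′ → ∃ λ es″ → Closed es″ × es″ ↭ es ++ es′
  merge es es′ c c′ meet with find meet
  ... | g , g∈es′ , visit with find visit
  ... | e , e∈es , eq with ∈-∃++ g∈es′ | ∈-∃++ e∈es
  ... | xs′ , ys′ , refl | xs , ys , refl =
    (e ∷ ys ++ xs) ++ (g ∷ ys′ ++ xs′) ,
    (src e , fromEdge (rotateClosed xs (e ∷ ys) c) ++ᵖ
             subst (λ v → Path v _ v) (sym eq) (fromEdge (rotateClosed xs′ (g ∷ ys′) c′))) ,
    ↭-trans (++⁺ʳ _ (++-comm (e ∷ ys) xs)) (++⁺ˡ (xs ++ e ∷ ys) (++-comm (g ∷ ys′) xs′))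

  -- The vertices visited by `es` are closed under adjacency: an edge at such a vertex that belonged
  -- to another circuit would make that circuit meet `es`.
  visitsAll : ∀ {all es ess} → all ↭ es ++ concat ess → Closed es → Allˡ.All Closed ess →
              ¬ Any (Meets es) ess → ∀ {u v} → EqClosure (Edge all) u v → Visits es u → Visits es v
  visitsAll {all} {es} {ess} all↭ c cs apart = go
    where
    edge : ∀ {e} → e ∈ˡ all → e ∈ˡ es ⊎ ∃ λ es′ → e ∈ˡ es′ × es′ ∈ˡ ess
    edge e∈ with ∈-++⁻ es (∈-resp-↭ all↭ e∈)
    ... | inj₁ e∈es  = inj₁ e∈es
    ... | inj₂ e∈ess = inj₂ (∈-concat⁻′ ess e∈ess)

    go : ∀ {u v} → EqClosure (Edge all) u v → Visits es u → Visits es v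
    go ε visit = visit
    go (fwd (e , e∈ , refl , refl) ◅ w) visit with edge e∈
    ... | inj₁ e∈es = go w (visitsTarget c e∈es)
    ... | inj₂ (es′ , e∈es′ , es′∈) = contradiction (lose es′∈ (lose e∈es′ visit)) apart
    go (bwd (e , e∈ , refl , refl) ◅ w) visit with edge e∈
    ... | inj₁ e∈es = go w (lose e∈es refl)
    ... | inj₂ (es′ , e∈es′ , es′∈) with find (visitsTarget (Allˡ.lookup cs es′∈) e∈es′)
    ... | g , g∈es′ , eq = contradiction (lose es′∈ (lose g∈es′ (subst (Visits es) (sym eq) visit))) apart

  -- Each merger absorbs one of the remaining circuits, and `n` bounds their number. The growing
  -- circuit is kept nonempty so that `visitsAll` has a vertex to start from.
  mergeAll : ∀ {all} n {e es} ess → length ess ≤ n → Connected all → all ↭ (e ∷ es) ++ concat ess →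
             Closed (e ∷ es) → Allˡ.All Closed ess → ∃ λ es′ → Closed es′ × all ↭ es′
  mergeAll {all} n {e} {es} ess len conn all↭ c cs
    with any? (any? λ g → any? (λ g′ → src g′ ≟ src g) (e ∷ es)) ess
  -- Nothing in the types prevents the remaining circuits from being empty lists, so it is their
  -- concatenation that is shown to be empty: the source of any edge in it would be visited by
  -- `e ∷ es`.
  ... | no apart = e ∷ es , c , ↭-trans all↭ (↭-reflexive (trans (cong ((e ∷ es) ++_) (empty (concat ess) λ ∈ → ∈)) (Listₚ.++-identityʳ _)))
    where
    empty : ∀ gs → (∀ {g} → g ∈ˡ gs → g ∈ˡ concat ess) → gs ≡ []
    empty []       _   = refl
    empty (g ∷ gs) sub with ∈-concat⁻′ ess (sub (here refl))
    ... | es′ , g∈es′ , es′∈ = contradiction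
      (lose es′∈ (lose g∈es′ (visitsAll all↭ c cs apart
        (conn (∈-resp-↭ (↭-sym all↭) (here refl)) (∈-resp-↭ (↭-sym all↭) (∈-++⁺ʳ (e ∷ es) (sub (here refl)))))
        (here refl)))) apart
  ... | yes meets with find meets
  ... | es′ , es′∈ , meet with ∈-∃++ es′∈
  mergeAll {all} zero    {e} {es} _ len conn all↭ c cs | yes meets | es′ , es′∈ , meet | [] , ess₂ , refl with () ← len
  mergeAll {all} zero    {e} {es} _ len conn all↭ c cs | yes meets | es′ , es′∈ , meet | _ ∷ _ , ess₂ , refl with () ← len
  mergeAll {all} (suc n) {e} {es} _ len conn all↭ c cs | yes meets | es′ , es′∈ , meet | ess₁ , ess₂ , refl
    with merge (e ∷ es) es′ c (Allˡ.lookup cs es′∈) meet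
  ... | [] , c″ , ↭″ = contradiction (↭-length ↭″) λ ()
  ... | g ∷ gs , c″ , ↭″ = mergeAll n (ess₁ ++ ess₂) len′ conn all↭′ c″ cs′
    where
    cs′ : Allˡ.All Closed (ess₁ ++ ess₂)
    cs′ with Allˡₚ.++⁻ ess₁ cs
    ... | cs₁ , _ ∷ cs₂ = Allˡₚ.++⁺ cs₁ cs₂
    len′ : length (ess₁ ++ ess₂) ≤ n
    len′ = s≤s⁻¹ (≤-trans (≤-reflexive (sym (↭-length (shift es′ ess₁ ess₂)))) len)
    all↭′ : all ↭ (g ∷ gs) ++ concat (ess₁ ++ ess₂)
    all↭′ = begin
      all                                                ↭⟨ all↭ ⟩
      (e ∷ es) ++ concat (ess₁ ++ es′ ∷ ess₂)            ≡⟨ cong ((e ∷ es) ++_) (Listₚ.concat-++ ess₁ (es′ ∷ ess₂)) ⟨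
      (e ∷ es) ++ concat ess₁ ++ es′ ++ concat ess₂      ↭⟨ ++⁺ˡ (e ∷ es) (shifts (concat ess₁) es′) ⟩
      (e ∷ es) ++ es′ ++ concat ess₁ ++ concat ess₂      ≡⟨ cong (λ xs → (e ∷ es) ++ es′ ++ xs) (Listₚ.concat-++ ess₁ ess₂) ⟩
      (e ∷ es) ++ es′ ++ concat (ess₁ ++ ess₂)           ≡⟨ Listₚ.++-assoc (e ∷ es) es′ _ ⟨
      ((e ∷ es) ++ es′) ++ concat (ess₁ ++ ess₂)         ↭⟨ ++⁺ʳ _ ↭″ ⟨
      (g ∷ gs) ++ concat (ess₁ ++ ess₂)                  ∎
      where open PermutationReasoning

  eulerianTrail : ∀ e es → Balanced (e ∷ es) → Connected (e ∷ es) → ∃ λ es′ → Closed es′ × e ∷ es ↭ es′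
  eulerianTrail e es bal conn =
    let es₁ , es₂ , c , es↭ , bal′ = peelClosed e es bal
        ess , cs , es₂↭ = decompose (length es₂) es₂ ≤-refl bal′ in
    mergeAll (length ess) ess ≤-refl conn (prep e (↭-trans es↭ (++⁺ˡ es₁ es₂↭))) c cs

-- Enumerations without repetition

module _ {A : Set} where

  -- Balance and all counts below come from this: one finite set is enumerated in two ways, and
  -- degrees, sums and lengths are compared along the permutation.
  sameElements⇒↭ : ∀ {xs ys : List A} → Unique xs → Unique ys → (∀ {x} → x ∈ˡ xs ⇔ x ∈ˡ ys) → xs ↭ ys
  sameElements⇒↭ xs! ys! same = ∼bag⇒↭ (unique∧set⇒bag xs! ys! same)

  map-unique : ∀ {B : Set} (g : A → B) {xs} → (∀ {x y} → x ∈ˡ xs → y ∈ˡ xs → g x ≡ g y → x ≡ y) →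
               Unique xs → Unique (List.map g xs)
  map-unique g inj []           = []
  map-unique g inj (x∉xs ∷ xs!) = Allˡ.tabulate fresh ∷ map-unique g (λ x∈ y∈ → inj (there x∈) (there y∈)) xs!
    where
    fresh : ∀ {y} → y ∈ˡ List.map g _ → g _ ≢ y
    fresh y∈ eq with ∈-map⁻ g y∈
    ... | z , z∈ , refl = Allˡ.lookup x∉xs z∈ (inj (here refl) (there z∈) eq)

  lookup-injective : ∀ {xs : List A} → Unique xs → ∀ {i j} → List.lookup xs i ≡ List.lookup xs j → i ≡ j
  lookup-injective (_ ∷ _)      {Fin.zero}  {Fin.zero}  _  = refl
  lookup-injective (x∉xs ∷ _)   {Fin.zero}  {Fin.suc j} eq = contradiction eq (Allˡ.lookup x∉xs (∈-lookup j))
  lookup-injective (x∉xs ∷ _)   {Fin.suc i} {Fin.zero}  eq = contradiction (sym eq) (Allˡ.lookup x∉xs (∈-lookup i))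
  lookup-injective (_ ∷ xs!)    {Fin.suc i} {Fin.suc j} eq = cong Fin.suc (lookup-injective xs! eq)

  tuples : List A → ∀ r → List (Vec A r)
  tuples xs zero    = List.[ [] ]
  tuples xs (suc r) = cartesianProductWith _∷_ xs (tuples xs r)

  tuples-unique : ∀ {xs} → Unique xs → ∀ r → Unique (tuples xs r)
  tuples-unique xs! zero    = [] ∷ []
  tuples-unique xs! (suc r) = Unique.cartesianProductWith⁺ _∷_ ∷-injective xs! (tuples-unique xs! r)

  ∈-tuples⁺ : ∀ xs {r} {v : Vec A r} → All (_∈ˡ xs) v → v ∈ˡ tuples xs r
  ∈-tuples⁺ xs []       = here refl
  ∈-tuples⁺ xs (x∈ ∷ v) = ∈-cartesianProductWith⁺ _∷_ x∈ (∈-tuples⁺ xs v)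

  ∈-tuples⁻ : ∀ xs {r} {v : Vec A r} → v ∈ˡ tuples xs r → All (_∈ˡ xs) v
  ∈-tuples⁻ xs {zero}  {[]} _  = []
  ∈-tuples⁻ xs {suc r} {v}  v∈ with ∈-cartesianProductWith⁻ _∷_ xs (tuples xs r) v∈
  ... | x , w , x∈ , w∈ , refl = x∈ ∷ ∈-tuples⁻ xs w∈

  length-tuples : ∀ xs r → length (tuples xs r) ≡ length xs ^ r
  length-tuples xs zero    = refl
  length-tuples xs (suc r) = trans (length-product xs) (cong (length xs *_) (length-tuples xs r))
    where
    length-product : ∀ ys → length (cartesianProductWith _∷_ ys (tuples xs r)) ≡ length ys * length (tuples xs r)
    length-product []       = refl
    length-product (y ∷ ys) = trans (Listₚ.length-++ (List.map (y ∷_) (tuples xs r)))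
      (cong₂ _+_ (Listₚ.length-map (y ∷_) (tuples xs r)) (length-product ys))

∈-tuples-allFin : ∀ {k r} (v : Tuple k r) → v ∈ˡ tuples (allFin k) r
∈-tuples-allFin {k} v = ∈-tuples⁺ (allFin k) (everywhere v)
  where
  everywhere : ∀ {r} (v : Tuple k r) → All (_∈ˡ allFin k) v
  everywhere []      = []
  everywhere (x ∷ v) = ∈-allFin x ∷ everywhere v

%-≡⇒∣ : ∀ i j n .{{_ : NonZero n}} → i % n ≡ j % n → n ∣ ∣ i - j ∣
%-≡⇒∣ i j n eq = divides ∣ i / n - j / n ∣ (begin
  ∣ i - j ∣                                          ≡⟨ cong₂ ∣_-_∣ (m≡m%n+[m/n]*n i n) (m≡m%n+[m/n]*n j n) ⟩
  ∣ i % n + i / n * n - (j % n + j / n * n) ∣        ≡⟨ cong (λ r → ∣ i % n + i / n * n - (r + j / n * n) ∣) (sym eq) ⟩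
  ∣ i % n + i / n * n - (i % n + j / n * n) ∣        ≡⟨ ∣m+n-m+o∣≡∣n-o∣ (i % n) (i / n * n) (j / n * n) ⟩
  ∣ i / n * n - j / n * n ∣                          ≡⟨ *-distribʳ-∣-∣ n (i / n) (j / n) ⟨
  ∣ i / n - j / n ∣ * n                              ∎)
  where open ≡-Reasoning

suc-% : ∀ i n .{{_ : NonZero n}} → suc (i % n) ≡ n ⊎ suc i % n ≡ suc (i % n)
suc-% i n with suc (i % n) ≟ n
... | yes eq = inj₁ eq
... | no neq = inj₂ (trans (sym (%-absorbʳ 1 i n)) (m<n⇒m%n≡m (≤∧≢⇒< (m%n<n i n) neq)))

module ClosedTrail {A V : Set} (_≟_ : DecidableEquality V) (src tgt : A → V) where
  open Euler _≟_ src tgt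

  firstSource : ∀ {u es v} → Path u es v → ∀ j → toℕ j ≡ 0 → u ≡ src (List.lookup es j)
  firstSource (e ∷ p) Fin.zero _ = refl

  lastTarget : ∀ {u es v} → Path u es v → ∀ i → suc (toℕ i) ≡ length es → tgt (List.lookup es i) ≡ v
  lastTarget (e ∷ p) Fin.zero    eq = empty p (suc-injective eq)
    where
    empty : ∀ {u es v} → Path u es v → 0 ≡ length es → u ≡ v
    empty [] _ = refl
  lastTarget (e ∷ p) (Fin.suc i) eq = lastTarget p i (suc-injective eq)

  consecutive : ∀ {u es v} → Path u es v → ∀ i j → toℕ j ≡ suc (toℕ i) →
                tgt (List.lookup es i) ≡ src (List.lookup es j)
  consecutive (e ∷ p) Fin.zero    (Fin.suc j) eq = firstSource p j (suc-injective eq)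
  consecutive (e ∷ p) (Fin.suc i) (Fin.suc j) eq = consecutive p i j (suc-injective eq)

  -- Read with indices modulo its length, a closed path is an infinite walk. Closedness enters at
  -- the wrap from the last index to 0.
  closed-walk : ∀ {e es} → Closed (e ∷ es) → ∀ i →
                tgt (List.lookup (e ∷ es) (i mod suc (length es))) ≡
                src (List.lookup (e ∷ es) (suc i mod suc (length es)))
  closed-walk {e} {es} (v , p) i with suc-% i (suc (length es))
  ... | inj₂ eq   = consecutive p _ _ (trans (toℕ-mod (suc i) n) (trans eq (cong suc (sym (toℕ-mod i n)))))
    where
    n : ℕ
    n = suc (length es)
  ... | inj₁ wrap = trans (lastTarget p _ (trans (cong suc (toℕ-mod i n)) wrap))
                          (firstSource p _ (trans (toℕ-mod (suc i) n) zero%))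
    where
    n : ℕ
    n = suc (length es)
    zero% : suc i % n ≡ 0
    zero% = trans (sym (%-absorbʳ 1 i n)) (trans (cong (_% n) wrap) (n%n≡0 n))

-- A set of edges of a de Bruijn graph permuted by φ in such a way that φ e
-- starts where e ends.
record Succession {k r} (E : Pred (Tuple k (suc r)) 0ℓ) : Set where
  field
    E?   : Decidable E
    φ ψ  : Tuple k (suc r) → Tuple k (suc r)
    φ-∈  : ∀ {e} → e ∈ E → φ e ∈ E
    ψ-∈  : ∀ {e} → e ∈ E → ψ e ∈ E
    ψ-φ  : ∀ {e} → e ∈ E → ψ (φ e) ≡ e
    φ-ψ  : ∀ {e} → e ∈ E → φ (ψ e) ≡ e
    walk : ∀ {e} → e ∈ E → init (φ e) ≡ tail e

module _ {k r} {E : Pred (Tuple k (suc r)) 0ℓ} (succession : Succession E) where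

  open Succession succession

  private
    module Eu = Euler (_≟ᵗ_ {k} {r}) (init {A = Fin k}) tail

  edgeList : List (Tuple k (suc r))
  edgeList = filter E? (tuples (allFin k) (suc r))

  edgeList-unique : Unique edgeList
  edgeList-unique = Unique.filter⁺ E? (tuples-unique (Unique.allFin⁺ k) (suc r))

  ∈-edgeList : ∀ {e} → e ∈ˡ edgeList ⇔ e ∈ E
  ∈-edgeList = mk⇔ (λ e∈ → proj₂ (∈-filter⁻ E? {xs = tuples (allFin k) (suc r)} e∈)) (∈-filter⁺ E? (∈-tuples-allFin _))

  φ-edgeList : List.map φ edgeList ↭ edgeList
  φ-edgeList = sameElements⇒↭ (map-unique φ injective edgeList-unique) edgeList-unique (mk⇔ into onto)
    where
    injective : ∀ {e e′} → e ∈ˡ edgeList → e′ ∈ˡ edgeList → φ e ≡ φ e′ → e ≡ e′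
    injective e∈ e′∈ eq = trans (sym (ψ-φ (to ∈-edgeList e∈))) (trans (cong ψ eq) (ψ-φ (to ∈-edgeList e′∈)))
    into : ∀ {e} → e ∈ˡ List.map φ edgeList → e ∈ˡ edgeList
    into e∈ with ∈-map⁻ φ e∈
    ... | e′ , e′∈ , refl = from ∈-edgeList (φ-∈ (to ∈-edgeList e′∈))
    onto : ∀ {e} → e ∈ˡ edgeList → e ∈ˡ List.map φ edgeList
    onto {e} e∈ = subst (_∈ˡ List.map φ edgeList) (φ-ψ (to ∈-edgeList e∈)) (∈-map⁺ φ (from ∈-edgeList (ψ-∈ (to ∈-edgeList e∈))))

  -- The tails of the edges are the sources of their images under `φ`, and these images are the same
  -- edges in another order.
  balancedEdges : Eu.Balanced edgeList
  balancedEdges v = trans (sym (Eu.degree-↭ init v φ-edgeList)) (follow edgeList (λ e∈ → walk (to ∈-edgeList e∈)))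
    where
    follow : ∀ es → (∀ {e} → e ∈ˡ es → init (φ e) ≡ tail e) → Eu.degree init v (List.map φ es) ≡ Eu.degree tail v es
    follow []       _  = refl
    follow (e ∷ es) eq = begin
      Eu.degree init v (φ e ∷ List.map φ es)                       ≡⟨ Eu.degree-∷ init v (φ e) (List.map φ es) ⟩
      Eu.δ (init (φ e)) v + Eu.degree init v (List.map φ es)       ≡⟨ cong₂ (λ u d → Eu.δ u v + d) (eq (here refl))
          (follow es (eq ∘ there)) ⟩
      Eu.δ (tail e) v + Eu.degree tail v es                        ≡⟨ Eu.degree-∷ tail v e es ⟨
      Eu.degree tail v (e ∷ es)                                    ∎
      where open ≡-Reasoning

  degree-size : ∀ (g : Tuple k (suc r) → Tuple k r) v → HasSize (λ e → e ∈ E × g e ≡ v) (Eu.degree g v edgeList)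
  degree-size g v = filter at edgeList , Unique.filter⁺ at edgeList-unique ,
    (λ e → mk⇔ (λ e∈ → let e∈′ , eq = ∈-filter⁻ at {xs = edgeList} e∈ in to ∈-edgeList e∈′ , eq)
               (λ (e∈ , eq) → ∈-filter⁺ at (from ∈-edgeList e∈) eq)) , refl
    where
    at : Decidable (λ e → g e ≡ v)
    at e = g e ≟ᵗ v

  balanced : ∀ v → ∃ λ d → InDegree (edgeInduced E) v d × OutDegree (edgeInduced E) v d
  balanced v = Eu.degree tail v edgeList , degree-size tail v ,
    subst (HasSize _) (balancedEdges v) (degree-size init v)

  IsEulerianSequence : (ℕ → Fin k) → Set
  IsEulerianSequence s = IsWindowSequence k (suc r) s (length edgeList) × (∀ a → Occurs s a ⇔ a ∈ E)

  eulerianSequence : ∃ E → (∀ {e e′} → e ∈ E → e′ ∈ E → EqClosure (Adjacent (edgeInduced E)) (init e) (init e′)) →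
                     ∃ IsEulerianSequence
  -- The given edge rules out an empty edge list and so provides a start for the trail and a
  -- positive period.
  eulerianSequence (e₀ , e₀∈E) connected with edgeList in eq | from ∈-edgeList e₀∈E
  ... | e ∷ es | _ = fromTrail (Eu.eulerianTrail e es (subst Eu.Balanced eq balancedEdges) connected′)
    where
    toE : ∀ {e′} → e′ ∈ˡ e ∷ es → e′ ∈ E
    toE e∈ = to ∈-edgeList (subst (_ ∈ˡ_) (sym eq) e∈)
    fromE : ∀ {e′} → e′ ∈ E → e′ ∈ˡ e ∷ es
    fromE e∈ = subst (_ ∈ˡ_) eq (from ∈-edgeList e∈)

    connected′ : Eu.Connected (e ∷ es)
    connected′ e∈ e′∈ = EqClosure.map (λ (g , g∈E , ends) → g , fromE g∈E , ends) (connected (toE e∈) (toE e′∈))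

    open PermutationSetoid (setoid (Tuple k (suc r))) using (Unique-resp-↭)

    fromTrail : (∃ λ es′ → Eu.Closed es′ × e ∷ es ↭ es′) → ∃ λ s → IsWindowSequence k (suc r) s (suc (length es)) ×
        (∀ a → Occurs s a ⇔ a ∈ E)
    fromTrail ([] , _ , perm) = contradiction (↭-length perm) λ ()
    fromTrail (g ∷ gs , closed , perm) = head ∘ h , subst (IsWindowSequence k (suc r) (head ∘ h)) (sym
        (↭-length perm)) isWindow , λ a → mk⇔ (sound a) (complete a)
      where
      p : ℕ
      p = suc (length gs)
      h : ℕ → Tuple k (suc r)
      h i = List.lookup (g ∷ gs) (i mod p)
      window-h : ∀ i → window (suc r) (head ∘ h) i ≡ h i
      window-h = window-walk r h (ClosedTrail.closed-walk (_≟ᵗ_ {k} {r}) init tail closed)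
      unique : Unique (g ∷ gs)
      unique = Unique-resp-↭ (↭⇒↭ₛ perm) (subst Unique eq edgeList-unique)
      isWindow : IsWindowSequence k (suc r) (head ∘ h) p
      isWindow = record
        { positive = s≤s z≤n
        ; periodic = λ i → cong (λ j → head (List.lookup (g ∷ gs) j)) (mod-cong (i + p) i p ([m+n]%n≡m%n i p))
        ; distinct = λ i j same → %-≡⇒∣ i j p (begin
            i % p          ≡⟨ toℕ-mod i p ⟨
            toℕ (i mod p)  ≡⟨ cong toℕ (lookup-injective unique (trans (sym (window-h i)) (trans same (window-h j)))) ⟩
            toℕ (j mod p)  ≡⟨ toℕ-mod j p ⟩
            j % p          ∎)
        }
        where open ≡-Reasoning
      sound : ∀ a → Occurs (head ∘ h) a → a ∈ E
      sound a (i , refl) = subst (_∈ E) (sym (window-h i)) (toE (∈-resp-↭ (↭-sym perm) (∈-lookup (i mod p))))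
      complete : ∀ a → a ∈ E → Occurs (head ∘ h) a
      complete a a∈E = toℕ j , trans (window-h (toℕ j)) (trans (cong (List.lookup (g ∷ gs)) (mod-toℕ j)) (sym (Anyₚ.lookup-index a∈)))
        where
        a∈ : a ∈ˡ g ∷ gs
        a∈ = ∈-resp-↭ perm (fromE a∈E)
        j : Fin p
        j = index a∈

-- The graph Z

data Sign {k} (x : Fin k) : Set where
  selfNegative : ⊝ x ≡ x → Sign x
  lower        : 0 < toℕ x → 2 * toℕ x < k → Sign x
  upper        : 0 < toℕ (⊝ x) → 2 * toℕ (⊝ x) < k → Sign x

module Signs (l : ℕ) where

  open Residues l

  private
    k : ℕ
    k = suc l

  ⊝-complement : ∀ (x : Fin k) → 0 < toℕ x → toℕ (⊝ x) + toℕ x ≡ k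
  ⊝-complement (Fin.suc u) _ = trans (cong (_+ suc (toℕ u)) (⊝-suc u))
    (trans (+-suc (l ∸ toℕ u) (toℕ u)) (cong suc (m∸n+n≡m (<⇒≤ (toℕ<n u)))))

  sign : ∀ (x : Fin k) → Sign x
  sign Fin.zero      = selfNegative ⊝-zero
  sign x@(Fin.suc u) with <-cmp (2 * toℕ x) k
  ... | tri< lt _ _ = lower (s≤s z≤n) lt
  ... | tri≈ _ eq _ = selfNegative (doubleWeight≡k⇒selfNegative x eq)
  ... | tri> _ _ gt = upper (subst (0 <_) (sym (⊝-suc u)) (m<n⇒0<n∸m (toℕ<n u)))
    (+-cancelʳ-< (2 * toℕ x) _ _ (begin-strict
      2 * toℕ (⊝ x) + 2 * toℕ x ≡⟨ *-distribˡ-+ 2 (toℕ (⊝ x)) (toℕ x) ⟨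
      2 * (toℕ (⊝ x) + toℕ x)   ≡⟨ cong (2 *_) (⊝-complement x (s≤s z≤n)) ⟩
      2 * k                     ≡⟨ cong (k +_) (+-identityʳ k) ⟩
      k + k                     <⟨ +-monoʳ-< k gt ⟩
      k + 2 * toℕ x             ∎))
    where open ≤-Reasoning

  -- The representatives of x and -x add up to k, so they cannot both lie below k/2.
  lower-⊝ : ∀ (x : Fin k) → 0 < toℕ x → 2 * toℕ x < k → ¬ 2 * toℕ (⊝ x) < k
  lower-⊝ x pos lt lt′ = <-irrefl (begin
      2 * toℕ (⊝ x) + 2 * toℕ x ≡⟨ *-distribˡ-+ 2 (toℕ (⊝ x)) (toℕ x) ⟨
      2 * (toℕ (⊝ x) + toℕ x)   ≡⟨ cong (2 *_) (⊝-complement x pos) ⟩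
      2 * k                     ≡⟨ cong (k +_) (+-identityʳ k) ⟩
      k + k                     ∎) (+-mono-< lt′ lt)
    where open ≡-Reasoning

  -- If no entry exceeds k/2, the pseudoweight is at most nk/2, and equality makes every entry weigh
  -- k/2 and hence be self-negative. A tuple of a chosen circuit, which has pseudoweight nk/2
  -- without being self-negative, must therefore have an entry above average.
  heavyEntry : ∀ {n} (v : Tuple k n) →
               (∃ λ i → k < doubleWeight (lookup v i)) ⊎ (weight v ≤ n * k × (weight v ≡ n * k → neg v ≡ v))
  heavyEntry []      = inj₂ (z≤n , λ _ → refl)
  heavyEntry {suc n} (x ∷ v) with heavyEntry v | k <? doubleWeight x
  ... | inj₁ (i , gt) | _      = inj₁ (Fin.suc i , gt)
  ... | inj₂ _        | yes gt = inj₁ (Fin.zero , gt)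
  ... | inj₂ (v≤ , v-self) | no ≯ = inj₂ (+-mono-≤ x≤ v≤ , λ eq →
        cong₂ _∷_ (doubleWeight≡k⇒selfNegative x (x≡ eq)) (v-self (+-cancelˡ-≡ k _ _ (trans (cong (_+ weight v) (sym (x≡ eq))) eq))))
    where
    x≤ : doubleWeight x ≤ k
    x≤ = ≮⇒≥ ≯
    x≡ : doubleWeight x + weight v ≡ k + n * k → doubleWeight x ≡ k
    x≡ eq = ≤-antisym x≤ (+-cancelʳ-≤ (n * k) k (doubleWeight x) (≤-trans (≤-reflexive (sym eq)) (+-monoʳ-≤ (doubleWeight x) v≤)))

module ChosenTuples (l m : ℕ) (choice : CircuitChoice (suc l) m) where

  open Residues l
  open Differences l
  open CircuitChoice choice

  private
    k n : ℕ
    k = suc l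
    n = suc m

  Chosen-weight : ∀ t → t ∈ Chosen → weight t ≡ n * k
  Chosen-weight t t∈ = trans (half-injective (trans (sym (w*≡half t)) (proj₂ (sound t t∈)))) (*-comm k n)

  weight-C* : ∀ t → neg t ≢ t → weight t ≡ n * k → t ∈ C* k n
  weight-C* t t≢ eq = t≢ , trans (w*≡half t) (cong half (trans eq (*-comm n k)))

  -- The choice is an arbitrary predicate, yet its axioms decide it: outside `C*` it is refuted by
  -- `sound`, and on `C*` the proof `atLeast` names one of the two circuits while `atMost` rules out
  -- the other.
  Chosen? : Decidable Chosen
  Chosen? t with neg t ≟ᵗ t | weight t ≟ n * k
  ... | yes self | _     = no λ t∈ → proj₁ (sound t t∈) self
  ... | no _     | no w≢ = no λ t∈ → w≢ (Chosen-weight t t∈)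
  ... | no t≢    | yes w≡ with atLeast t (weight-C* t t≢ w≡)
  ... | inj₁ t∈  = yes t∈
  ... | inj₂ -t∈ = no λ t∈ → atMost t t∈ -t∈

  -- Since `Chosen` is invariant under rotation, the union of the chosen circuits is `Chosen`
  -- itself.
  data FCase (t : Tuple k n) : Set where
    light  : weight t < n * k → FCase t
    chosen : t ∈ Chosen → FCase t

  F⇒case : ∀ {t} → t ∈ F choice → FCase t
  F⇒case {t} (inj₁ t∈)                   = light (E*⇒weight {v = t} t∈)
  F⇒case (inj₂ (a , a∈ , a-rotates)) = chosen (rotation a _ a∈ a-rotates)

  case⇒F : ∀ {t} → FCase t → t ∈ F choice
  case⇒F {t} (light lt)   = inj₁ (weight⇒E* {v = t} lt)
  case⇒F {t} (chosen t∈) = inj₂ (t , t∈ , 0 , rotate-zero t)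

  F? : Decidable (F choice)
  F? t with weight t <? n * k | Chosen? t
  ... | yes lt | _      = yes (case⇒F (light lt))
  ... | no _   | yes t∈ = yes (case⇒F (chosen t∈))
  ... | no ≮   | no ∉   = no λ t∈ → [ ≮ , ∉ ]′ (split (F⇒case t∈))
    where
    split : FCase t → weight t < n * k ⊎ t ∈ Chosen
    split (light lt)  = inj₁ lt
    split (chosen t∈) = inj₂ t∈

  private
    weights : ∀ (t : Tuple k n) → weight (neg t) + weight t ≡ n * k + n * k
    weights t = trans (weight-neg t) (cong (n * k +_) (+-identityʳ (n * k)))

  -- The doubled weights of `t` and `neg t` add up to 2nk and neither exceeds nk, so both equal nk.
  -- Then both tuples are chosen, against `atMost`.
  F-exclusive : ∀ {t} → t ∈ F choice → ¬ neg t ∈ F choice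
  F-exclusive {t} t∈ -t∈ with F⇒case t∈ | F⇒case -t∈
  ... | light lt  | light lt′  = <-irrefl (weights t) (+-mono-< lt′ lt)
  ... | light lt  | chosen -t∈ = <-irrefl (weights t) (+-mono-≤-< (≤-reflexive (Chosen-weight (neg t) -t∈)) lt)
  ... | chosen t∈ | light lt′  = <-irrefl (weights t) (+-mono-<-≤ lt′ (≤-reflexive (Chosen-weight t t∈)))
  ... | chosen t∈ | chosen -t∈ = atMost t t∈ -t∈

  F-total : ∀ t → neg t ≢ t → t ∈ F choice ⊎ neg t ∈ F choice
  F-total t t≢ with <-cmp (weight t) (n * k)
  ... | tri< lt _ _ = inj₁ (case⇒F (light lt))
  ... | tri> _ _ gt = inj₂ (case⇒F (light (+-cancelʳ-< (weight t) (weight (neg t)) (n * k) (≤-<-trans (≤-reflexive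
      (weights t)) (+-monoʳ-< (n * k) gt)))))
  ... | tri≈ _ eq _ with atLeast t (weight-C* t t≢ eq)
  ... | inj₁ t∈  = inj₁ (case⇒F (chosen t∈))
  ... | inj₂ -t∈ = inj₂ (case⇒F (chosen -t∈))

  -- This separates the two kinds of edges of Z, because the differences along b_x are
  -- self-negative.
  F-notSelfNegative : ∀ {t} → t ∈ F choice → neg t ≢ t
  F-notSelfNegative t∈ eq = F-exclusive t∈ (subst (_∈ F choice) (sym eq) t∈)

  F-rotate : ∀ {x v} → x ∷ v ∈ F choice → v ∷ʳ x ∈ F choice
  F-rotate {x} {v} t∈ with F⇒case t∈
  ... | light lt  = case⇒F (light (subst (_< n * k) (sym (weight-∷ʳ v x)) lt))
  ... | chosen t∈ = case⇒F (chosen (rotation _ _ t∈ (1 , rotate-one x v)))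

  F-unrotate : ∀ {x v} → v ∷ʳ x ∈ F choice → x ∷ v ∈ F choice
  F-unrotate {x} {v} t∈ with F⇒case t∈
  ... | light lt  = case⇒F (light (subst (_< n * k) (weight-∷ʳ v x) lt))
  ... | chosen t∈ = case⇒F (chosen (rotation _ _ t∈ (m , rotate-last x v)))

-- The common structure of the circuits b_x: translates of one self-negative
-- sequence c whose differences run through the self-negative tuples.
record CircuitFamily (k m : ℕ) (B : Fin k → Pred (Tuple k (2 + m)) 0ℓ) : Set where
  field
    c            : ℕ → Fin k
    pred-period  : ℕ
    periodic     : ∀ i → c (i + suc pred-period) ≡ c i
    c-negative   : ∀ i → ⊝ (c i) ≡ c i
    member       : ∀ x e → e ∈ B x ⇔ ∃ λ i → window (2 + m) (λ j → x ⊕ c j) i ≡ e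
    locate       : ∀ t → neg t ≡ t → ∃ λ i → D (window (2 + m) c i) ≡ t
    separate     : ∀ i j → D (window (2 + m) c i) ≡ D (window (2 + m) c j) → ∀ d → c (i + d) ≡ c (j + d)

module ZGraph (l m : ℕ) (choice : CircuitChoice (suc l) m) {B : Fin (suc l) → Pred (Tuple (suc l) (2 + m)) 0ℓ}
              (circuits : CircuitFamily (suc l) m B) where

  open Residues l
  open Differences l
  open Signs l
  open ChosenTuples l m choice
  open CircuitFamily circuits

  private
    k n : ℕ
    k = suc l
    n = suc m

  -- With `b β` for `B` this unfolds to the edge set of `Z choice β`. Abstracting `B` lets one
  -- argument serve both parities of `k`.
  Zᴱ : Pred (Tuple k (suc n)) 0ℓ
  Zᴱ e = D e ∈ F choice ⊎ ∃ λ x → 0 < toℕ x × 2 * toℕ x < k × e ∈ B x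

  onCircuit : Fin k → ℕ → Tuple k (suc n)
  onCircuit x i = window (suc n) (λ j → x ⊕ c j) i

  D-onCircuit : ∀ x i → D (onCircuit x i) ≡ D (window (suc n) c i)
  D-onCircuit x i = trans (cong D (map-window (suc n) x c i)) (D-translate x (window (suc n) c i))

  head-onCircuit : ∀ x i → head (onCircuit x i) ≡ x ⊕ c i
  head-onCircuit x i = head-window n (λ j → x ⊕ c j) i

  neg-onCircuit : ∀ x i → neg (onCircuit x i) ≡ onCircuit (⊝ x) i
  neg-onCircuit x i = trans (neg-window (suc n) (λ j → x ⊕ c j) i) (window-cong (suc n) (λ j → ⊝ (x ⊕ c j)) (λ j → ⊝ x ⊕ c j) i i λ y →
    trans (sym (⊝-⊕-comm x (c (i + y)))) (cong (⊝ x ⊕_) (c-negative (i + y))))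

  D-onCircuit-negative : ∀ x i → neg (D (onCircuit x i)) ≡ D (onCircuit x i)
  D-onCircuit-negative x i = begin
    neg (D (onCircuit x i))     ≡⟨ D-neg (onCircuit x i) ⟨
    D (neg (onCircuit x i))     ≡⟨ cong D (neg-onCircuit x i) ⟩
    D (onCircuit (⊝ x) i)       ≡⟨ D-onCircuit (⊝ x) i ⟩
    D (window (suc n) c i)      ≡⟨ D-onCircuit x i ⟨
    D (onCircuit x i)           ∎
    where open ≡-Reasoning

  -- A classification of all (n+1)-tuples, edges of Z or not: here x ranges over all residues, since
  -- negation leads out of the range 0 < x < k/2.
  data Position : Tuple k (suc n) → Set where
    onCircuitAt : ∀ x i → Position (onCircuit x i)
    offCircuit  : ∀ {e} → neg (D e) ≢ D e → Position e

  -- If the differences of `e` are self-negative, `locate` finds a stretch of `c` with the same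
  -- differences. `e` is then a translate of that stretch, and comparing first entries gives x.
  position : ∀ e → Position e
  position e with neg (D e) ≟ᵗ D e
  ... | no D≢    = offCircuit D≢
  ... | yes self = let i , eq = locate (D e) self ; x = head e ⊖ c i in
    subst Position
      (D-injective (onCircuit x i) e (trans (head-onCircuit x i) (⊖-⊕ (head e) (c i))) (trans (D-onCircuit x i) eq))
      (onCircuitAt x i)

  -- Taking differences removes the translation, so `separate` makes `c` agree from `i` and `j`
  -- onwards; the first entries then give x = y. Thus the circuits for different x share no edge,
  -- and the next edge on a circuit is well defined.
  onCircuit-injective : ∀ {x y} i j → onCircuit x i ≡ onCircuit y j → x ≡ y × ∀ d → c (i + d) ≡ c (j + d)
  onCircuit-injective {x} {y} i j eq = ⊕-cancelʳ (c j) x y (begin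
      x ⊕ c j            ≡⟨ cong (x ⊕_) ci≡cj ⟨
      x ⊕ c i            ≡⟨ head-onCircuit x i ⟨
      head (onCircuit x i) ≡⟨ cong head eq ⟩
      head (onCircuit y j) ≡⟨ head-onCircuit y j ⟩
      y ⊕ c j            ∎) , same
    where
    open ≡-Reasoning
    same : ∀ d → c (i + d) ≡ c (j + d)
    same = separate i j (trans (sym (D-onCircuit x i)) (trans (cong D eq) (D-onCircuit y j)))
    ci≡cj : c i ≡ c j
    ci≡cj = subst₂ (λ a b → c a ≡ c b) (+-identityʳ i) (+-identityʳ j) (same 0)

  ∈-onCircuit : ∀ {x i} → onCircuit x i ∈ Zᴱ → 0 < toℕ x × 2 * toℕ x < k
  ∈-onCircuit {x} {i} (inj₁ ∈F) = contradiction (D-onCircuit-negative x i) (F-notSelfNegative ∈F)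
  ∈-onCircuit {x} {i} (inj₂ (y , pos , lt , ∈B)) =
    let j , eq = to (member y (onCircuit x i)) ∈B in
    subst (λ z → 0 < toℕ z × 2 * toℕ z < k) (proj₁ (onCircuit-injective j i eq)) (pos , lt)

  onCircuit-∈ : ∀ {x} i → 0 < toℕ x → 2 * toℕ x < k → onCircuit x i ∈ Zᴱ
  onCircuit-∈ {x} i pos lt = inj₂ (x , pos , lt , from (member x (onCircuit x i)) (i , refl))

  ∈-offCircuit : ∀ {e} → neg (D e) ≢ D e → e ∈ Zᴱ → D e ∈ F choice
  ∈-offCircuit     _ (inj₁ ∈F) = ∈F
  ∈-offCircuit {e} D≢ (inj₂ (x , _ , _ , ∈B)) with to (member x e) ∈B
  ... | i , refl = contradiction (D-onCircuit-negative x i) D≢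

  Zᴱ? : Decidable Zᴱ
  Zᴱ? e = decide (position e)
    where
    decide : ∀ {e} → Position e → Dec (e ∈ Zᴱ)
    decide {e} (offCircuit D≢) = map′ inj₁ (∈-offCircuit D≢) (F? (D e))
    decide (onCircuitAt x i)   = map′ (λ (pos , lt) → onCircuit-∈ i pos lt) (∈-onCircuit {x} {i})
                                      (0 <? toℕ x ×-dec 2 * toℕ x <? k)

  exclusive : ∀ {e} → e ∈ Zᴱ → ¬ neg e ∈ Zᴱ
  exclusive {e} e∈ -e∈ = contradict (position e) e∈ -e∈
    where
    contradict : ∀ {e} → Position e → e ∈ Zᴱ → ¬ neg e ∈ Zᴱ
    contradict {e} (offCircuit D≢) e∈ -e∈ = F-exclusive (∈-offCircuit D≢ e∈) (subst (_∈ F choice) (D-neg e) (∈-offCircuit -D≢ -e∈))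
      where
      -D≢ : neg (D (neg e)) ≢ D (neg e)
      -D≢ eq = D≢ (trans (sym (D-neg e)) (trans (sym eq) (trans (cong neg (D-neg e)) (neg-involutive (D e)))))
    contradict (onCircuitAt x i) e∈ -e∈ =
      let pos , lt = ∈-onCircuit {x} {i} e∈ in
      lower-⊝ x pos lt (proj₂ (∈-onCircuit {⊝ x} {i} (subst (_∈ Zᴱ) (neg-onCircuit x i) -e∈)))

  -- The residues x that equal their negatives are absent from Z, but their circuits consist of
  -- self-negative tuples. Of any other x and its negative, one lies strictly between 0 and k/2.
  exhaustive : ∀ e → neg e ≢ e → e ∈ Zᴱ ⊎ neg e ∈ Zᴱ
  exhaustive e e≢ = search (position e) e≢
    where
    search : ∀ {e} → Position e → neg e ≢ e → e ∈ Zᴱ ⊎ neg e ∈ Zᴱ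
    search {e} (offCircuit D≢) _ =
      [ inj₁ ∘ inj₁ , (λ ∈F → inj₂ (inj₁ (subst (_∈ F choice) (sym (D-neg e)) ∈F))) ]′ (F-total (D e) D≢)
    search (onCircuitAt x i) e≢ = bySign (sign x)
      where
      bySign : Sign x → onCircuit x i ∈ Zᴱ ⊎ neg (onCircuit x i) ∈ Zᴱ
      bySign (selfNegative eq) = contradiction (trans (neg-onCircuit x i) (cong (λ y → onCircuit y i) eq)) e≢
      bySign (lower pos lt)    = inj₁ (onCircuit-∈ i pos lt)
      bySign (upper pos lt)    = inj₂ (subst (_∈ Zᴱ) (sym (neg-onCircuit x i)) (onCircuit-∈ i pos lt))

  -- The first difference is appended once more, or the last one prepended, so that it is the
  -- differences that rotate and not the entries.
  next prev : Tuple k (suc n) → Tuple k (suc n)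
  next e = tail e ∷ʳ (last e ⊕ head (D e))
  prev e = (head e ⊖ last (D e)) ∷ init e

  D-next : ∀ e → D (next e) ≡ tail (D e) ∷ʳ head (D e)
  D-next e@(x ∷ v) = begin
    D (v ∷ʳ (last e ⊕ head (D e)))              ≡⟨ D-∷ʳ v _ ⟩
    D v ∷ʳ ((last e ⊕ head (D e)) ⊖ last v)     ≡⟨ cong₂ (λ t y → t ∷ʳ ((y ⊕ head (D e)) ⊖ last v)) (sym (D-tail e)) (last-∷ x v) ⟩
    tail (D e) ∷ʳ ((last v ⊕ head (D e)) ⊖ last v) ≡⟨ cong (tail (D e) ∷ʳ_) (⊕-⊖ˡ (last v) (head (D e))) ⟩
    tail (D e) ∷ʳ head (D e)                    ∎
    where
    open ≡-Reasoning

  D-last : ∀ (e : Tuple k (suc n)) → last (D e) ≡ last e ⊖ last (init e)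
  D-last e = begin
    last (D e)                                            ≡⟨ cong (λ v → last (D v)) (init-∷ʳ-last e) ⟩
    last (D (init e ∷ʳ last e))                           ≡⟨ cong last (D-∷ʳ (init e) (last e)) ⟩
    last (D (init e) ∷ʳ (last e ⊖ last (init e)))         ≡⟨ last-∷ʳ _ (D (init e)) ⟩
    last e ⊖ last (init e)                                ∎
    where open ≡-Reasoning

  D-prev : ∀ e → D (prev e) ≡ last (D e) ∷ init (D e)
  D-prev e = begin
    D ((head e ⊖ last (D e)) ∷ init e)                       ≡⟨ D-∷ _ (init e) ⟩
    (head (init e) ⊖ (head e ⊖ last (D e))) ∷ D (init e)     ≡⟨ cong₂ (λ y t → (y ⊖ (head e ⊖ last (D e))) ∷ t)
        (head-init e) (sym (D-init e)) ⟩
    (head e ⊖ (head e ⊖ last (D e))) ∷ init (D e)            ≡⟨ cong (_∷ init (D e)) (⊖-⊖ (head e) (last (D e))) ⟩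
    last (D e) ∷ init (D e)                                  ∎
    where open ≡-Reasoning

  prev-next : ∀ e → prev (next e) ≡ e
  prev-next e@(x ∷ y ∷ v) = cong₂ _∷_ (begin
      head (next e) ⊖ last (D (next e))                ≡⟨ cong (λ t → y ⊖ last t) (D-next e) ⟩
      y ⊖ last (tail (D e) ∷ʳ head (D e))              ≡⟨ cong (y ⊖_) (last-∷ʳ (head (D e)) (tail (D e))) ⟩
      y ⊖ (y ⊖ x)                                      ≡⟨ ⊖-⊖ y x ⟩
      x                                                ∎) (init-∷ʳ _ (y ∷ v))
    where open ≡-Reasoning

  next-prev : ∀ e → next (prev e) ≡ e
  next-prev e = begin
    init e ∷ʳ (last (prev e) ⊕ head (D (prev e)))      ≡⟨ cong₂ (λ y t → init e ∷ʳ (y ⊕ head t)) (last-∷ (head e ⊖ last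
        (D e)) (init e)) (D-prev e) ⟩
    init e ∷ʳ (last (init e) ⊕ last (D e))             ≡⟨ cong (init e ∷ʳ_) (trans (⊕-comm (last (init e)) (last (D e)))
        (trans (cong (_⊕ last (init e)) (D-last e)) (⊖-⊕ (last e) (last (init e))))) ⟩
    init e ∷ʳ last e                                   ≡⟨ init-∷ʳ-last e ⟨
    e                                                  ∎
    where
    open ≡-Reasoning

  next-F : ∀ e → D e ∈ F choice → D (next e) ∈ F choice
  next-F e ∈F = subst (_∈ F choice) (sym (D-next e)) (F-rotate (subst (_∈ F choice) (sym (head∷tail (D e))) ∈F))

  prev-F : ∀ e → D e ∈ F choice → D (prev e) ∈ F choice
  prev-F e ∈F = subst (_∈ F choice) (sym (D-prev e)) (F-unrotate (subst (_∈ F choice) (init-∷ʳ-last (D e)) ∈F))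

  private
    -- The position is an argument because `position e` picks its own x and i, which need not be
    -- those by which an edge was given. `step-on` shows that the outcome does not depend on them.
    step : ℕ → (Tuple k (suc n) → Tuple k (suc n)) → ∀ {e} → Position e → Tuple k (suc n)
    step d g {e} (offCircuit _)    = g e
    step d g     (onCircuitAt x i) = onCircuit x (i + d)

    step-on : ∀ d g {e} (p : Position e) x i → onCircuit x i ≡ e → step d g p ≡ onCircuit x (i + d)
    step-on d g (offCircuit D≢) x i refl = contradiction (D-onCircuit-negative x i) D≢
    step-on d g (onCircuitAt y j) x i eq = realign (onCircuit-injective i j eq)
      where
      realign : x ≡ y × (∀ z → c (i + z) ≡ c (j + z)) → onCircuit y (j + d) ≡ onCircuit x (i + d)
      realign (refl , same) = window-cong (suc n) (λ y → x ⊕ c y) (λ y → x ⊕ c y) (j + d) (i + d) λ z → cong (x ⊕_) (begin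
        c (j + d + z)   ≡⟨ cong c (+-assoc j d z) ⟩
        c (j + (d + z)) ≡⟨ same (d + z) ⟨
        c (i + (d + z)) ≡⟨ cong c (+-assoc i d z) ⟨
        c (i + d + z)   ∎)
        where open ≡-Reasoning

    step-off : ∀ d g {e} (p : Position e) → D e ∈ F choice → step d g p ≡ g e
    step-off d g (offCircuit _)    ∈F = refl
    step-off d g (onCircuitAt x i) ∈F = contradiction (D-onCircuit-negative x i) (F-notSelfNegative ∈F)

  -- On a circuit, one place back is reached by going `pred-period` places forward, which spares
  -- subtracting indices.
  φ ψ : Tuple k (suc n) → Tuple k (suc n)
  φ e = step 1 next (position e)
  ψ e = step pred-period prev (position e)

  φ-on : ∀ x i → φ (onCircuit x i) ≡ onCircuit x (i + 1)
  φ-on x i = step-on 1 next (position (onCircuit x i)) x i refl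

  ψ-on : ∀ x i → ψ (onCircuit x i) ≡ onCircuit x (i + pred-period)
  ψ-on x i = step-on pred-period prev (position (onCircuit x i)) x i refl

  φ-off : ∀ e → D e ∈ F choice → φ e ≡ next e
  φ-off e = step-off 1 next (position e)

  ψ-off : ∀ e → D e ∈ F choice → ψ e ≡ prev e
  ψ-off e = step-off pred-period prev (position e)

  fullTurn : ∀ x i d → d ≡ suc pred-period → onCircuit x (i + d) ≡ onCircuit x i
  fullTurn x i d refl = window-cong (suc n) (λ y → x ⊕ c y) (λ y → x ⊕ c y) (i + d) i λ z → cong (x ⊕_) (begin
    c (i + d + z)   ≡⟨ cong c (trans (+-assoc i d z) (trans (cong (i +_) (+-comm d z)) (sym (+-assoc i z d)))) ⟩
    c (i + z + d)   ≡⟨ periodic (i + z) ⟩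
    c (i + z)       ∎)
    where open ≡-Reasoning

  data ZCase : Tuple k (suc n) → Set where
    off : ∀ {e} → D e ∈ F choice → ZCase e
    on  : ∀ x i → 0 < toℕ x → 2 * toℕ x < k → ZCase (onCircuit x i)

  Z⇒case : ∀ {e} → e ∈ Zᴱ → ZCase e
  Z⇒case (inj₁ ∈F) = off ∈F
  Z⇒case {e} (inj₂ (x , pos , lt , ∈B)) with to (member x e) ∈B
  ... | i , refl = on x i pos lt

  succession : Succession Zᴱ
  succession = record
    { E?   = Zᴱ?
    ; φ    = φ
    ; ψ    = ψ
    ; φ-∈  = φ-∈ ∘ Z⇒case
    ; ψ-∈  = ψ-∈ ∘ Z⇒case
    ; ψ-φ  = ψ-φ ∘ Z⇒case
    ; φ-ψ  = φ-ψ ∘ Z⇒case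
    ; walk = walk ∘ Z⇒case
    }
    where
    φ-∈ : ∀ {e} → ZCase e → φ e ∈ Zᴱ
    φ-∈ {e} (off ∈F)    = subst (_∈ Zᴱ) (sym (φ-off e ∈F)) (inj₁ (next-F e ∈F))
    φ-∈ (on x i pos lt) = subst (_∈ Zᴱ) (sym (φ-on x i)) (onCircuit-∈ (i + 1) pos lt)

    ψ-∈ : ∀ {e} → ZCase e → ψ e ∈ Zᴱ
    ψ-∈ {e} (off ∈F)    = subst (_∈ Zᴱ) (sym (ψ-off e ∈F)) (inj₁ (prev-F e ∈F))
    ψ-∈ (on x i pos lt) = subst (_∈ Zᴱ) (sym (ψ-on x i)) (onCircuit-∈ (i + pred-period) pos lt)

    ψ-φ : ∀ {e} → ZCase e → ψ (φ e) ≡ e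
    ψ-φ {e} (off ∈F) = trans (cong ψ (φ-off e ∈F))
      (trans (ψ-off (next e) (next-F e ∈F)) (prev-next e))
    ψ-φ (on x i pos lt) = trans (cong ψ (φ-on x i)) (trans (ψ-on x (i + 1))
      (trans (cong (onCircuit x) (+-assoc i 1 pred-period)) (fullTurn x i (1 + pred-period) refl)))

    φ-ψ : ∀ {e} → ZCase e → φ (ψ e) ≡ e
    φ-ψ {e} (off ∈F) = trans (cong φ (ψ-off e ∈F))
      (trans (φ-off (prev e) (prev-F e ∈F)) (next-prev e))
    φ-ψ (on x i pos lt) = trans (cong φ (ψ-on x i)) (trans (φ-on x (i + pred-period))
      (trans (cong (onCircuit x) (+-assoc i pred-period 1)) (fullTurn x i (pred-period + 1) (+-comm pred-period 1))))

    walk : ∀ {e} → ZCase e → init (φ e) ≡ tail e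
    walk {e} (off ∈F) = trans (cong init (φ-off e ∈F)) (init-∷ʳ _ (tail e))
    walk (on x i pos lt) = begin
      init (φ (onCircuit x i))           ≡⟨ cong init (φ-on x i) ⟩
      init (onCircuit x (i + 1))         ≡⟨ init-window n (λ j → x ⊕ c j) (i + 1) ⟩
      window n (λ j → x ⊕ c j) (i + 1)   ≡⟨ cong (window n (λ j → x ⊕ c j)) (+-comm i 1) ⟩
      window n (λ j → x ⊕ c j) (suc i)   ≡⟨ tail-window n (λ j → x ⊕ c j) i ⟨
      tail (onCircuit x i)               ∎
      where open ≡-Reasoning

-- Connectedness of Z

module _ {A : Set} where

  push : ∀ {r} → A → Vec A r → Vec A r
  push y v = tail (v ∷ʳ y)

  -- The sequence v, y, y, y, ... Pushing `y` slides a window along it, and `r` pushes take the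
  -- window past `v`.
  extend : ∀ {r} → Vec A r → A → ℕ → A
  extend []      y _       = y
  extend (x ∷ v) y zero    = x
  extend (x ∷ v) y (suc i) = extend v y i

  extend-end : ∀ {r} (v : Vec A r) y i → extend v y (i + r) ≡ y
  extend-end []              y i = refl
  extend-end {suc r} (x ∷ v) y i = trans (cong (extend (x ∷ v) y) (+-suc i r)) (extend-end v y i)

  window-extend : ∀ {r} (v : Vec A r) y → window r (extend v y) 0 ≡ v
  window-extend []      y = refl
  window-extend (x ∷ v) y = cong (x ∷_) (window-extend v y)

  tabulate-constant : ∀ r (y : A) → tabulate {n = r} (λ _ → y) ≡ replicate r y
  tabulate-constant zero    y = refl
  tabulate-constant (suc r) y = cong (y ∷_) (tabulate-constant r y)

  push-iterate : ∀ {r} (v : Vec A r) y i → fold v (push y) i ≡ window r (extend v y) i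
  push-iterate     v y zero    = sym (window-extend v y)
  push-iterate {r} v y (suc i) = begin
    push y (fold v (push y) i)                                ≡⟨ cong (push y) (push-iterate v y i) ⟩
    tail (window r (extend v y) i ∷ʳ y)                       ≡⟨ cong (λ z → tail (window r (extend v y) i ∷ʳ z)) (extend-end v y i) ⟨
    tail (window r (extend v y) i ∷ʳ extend v y (i + r))      ≡⟨ cong tail (window-∷ʳ r (extend v y) i) ⟨
    tail (window (suc r) (extend v y) i)                      ≡⟨ tail-window r (extend v y) i ⟩
    window r (extend v y) (suc i)                             ∎
    where open ≡-Reasoning

  push-all : ∀ {r} (v : Vec A r) y → fold v (push y) r ≡ replicate r y
  push-all {r} v y = trans (push-iterate v y r) (trans
    (tabulate-cong λ j → trans (cong (extend v y) (+-comm r (toℕ j))) (extend-end v y (toℕ j)))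
    (tabulate-constant r y))

  push-replicate : ∀ r (y : A) → push y (replicate r y) ≡ replicate r y
  push-replicate r y = cong tail (replicate-∷ʳ r)
    where
    replicate-∷ʳ : ∀ r → replicate r y ∷ʳ y ≡ y ∷ replicate r y
    replicate-∷ʳ zero    = refl
    replicate-∷ʳ (suc r) = cong (y ∷_) (replicate-∷ʳ r)

neg-init : ∀ {k r} (v : Tuple k (suc r)) → neg (init v) ≡ init (neg v)
neg-init (x ∷ [])    = refl
neg-init (x ∷ y ∷ v) = cong (⊝ x ∷_) (neg-init (y ∷ v))

neg-tail : ∀ {k r} (v : Tuple k (suc r)) → neg (tail v) ≡ tail (neg v)
neg-tail (x ∷ v) = refl

module ZConnected (l m : ℕ) (2<k : 2 < 2 + l) (choice : CircuitChoice (2 + l) (suc m))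
                  {B : Fin (2 + l) → Pred (Tuple (2 + l) (3 + m)) 0ℓ}
                  (circuits : CircuitFamily (2 + l) (suc m) B) where

  open Residues (suc l)
  open Differences (suc l)
  open Signs (suc l)
  open ChosenTuples (suc l) (suc m) choice
  open CircuitChoice choice
  open ZGraph (suc l) (suc m) choice circuits

  private
    k n : ℕ
    k = 2 + l
    n = 2 + m

    one : Fin k
    one = Fin.suc Fin.zero

  infix 4 _~_
  _~_ : Tuple k n → Tuple k n → Set
  _~_ = EqClosure (Adjacent (edgeInduced Zᴱ))

  ~-sym : ∀ {u v} → u ~ v → v ~ u
  ~-sym = EqClosure.symmetric _

  along : ∀ e → e ∈ Zᴱ → init e ~ tail e
  along e e∈ = fwd (e , e∈ , refl , refl) ◅ ε

  -- The 2 is the doubled weight of the difference 1. `D v` has n - 1 entries, so the inequality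
  -- says that the edge appending the difference 1 to `v` has its differences in E.
  Low : Tuple k n → Set
  Low v = 2 + weight (D v) < n * k

  climb : Tuple k n → Tuple k n
  climb v = tail (v ∷ʳ (last v ⊕ one))

  D-extend : ∀ (v : Tuple k n) → D (v ∷ʳ (last v ⊕ one)) ≡ D v ∷ʳ one
  D-extend v = trans (D-∷ʳ v (last v ⊕ one)) (cong (D v ∷ʳ_) (⊕-⊖ˡ (last v) one))

  D-climb : ∀ v → D (climb v) ≡ push one (D v)
  D-climb v = trans (sym (D-tail (v ∷ʳ (last v ⊕ one)))) (cong tail (D-extend v))

  weight-push : ∀ {r} (t : Tuple k r) → weight (push one t) ≤ weight t
  weight-push []      = z≤n
  weight-push (x ∷ t) = ≤-trans (≤-reflexive (weight-∷ʳ t one)) (+-monoˡ-≤ (weight t) (2≤doubleWeight (s≤s (s≤s z≤n)) x))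

  ~-climb : ∀ v → Low v → v ~ climb v
  ~-climb v low = subst (_~ climb v) (init-∷ʳ _ v) (along e (inj₁ (case⇒F (light (subst (_< n * k) (sym lighter) low)))))
    where
    e : Tuple k (suc n)
    e = v ∷ʳ (last v ⊕ one)
    lighter : weight (D e) ≡ 2 + weight (D v)
    lighter = trans (cong weight (D-extend v)) (weight-∷ʳ (D v) one)

  climb-Low : ∀ v → Low v → Low (climb v)
  climb-Low v low = ≤-<-trans (+-monoʳ-≤ 2 (≤-trans (≤-reflexive (cong weight (D-climb v))) (weight-push (D v)))) low

  ~-climbs : ∀ v → Low v → ∀ i → v ~ fold v climb i × Low (fold v climb i)
  ~-climbs v low zero    = ε , low
  ~-climbs v low (suc i) = let w , low′ = ~-climbs v low i in
    w ◅◅ ~-climb (fold v climb i) low′ , climb-Low (fold v climb i) low′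

  D-climbs : ∀ v i → D (fold v climb i) ≡ fold (D v) (push one) i
  D-climbs v zero    = refl
  D-climbs v (suc i) = trans (D-climb (fold v climb i)) (cong (push one) (D-climbs v i))

  Summit : Tuple k n → Set
  Summit v = D v ≡ replicate (suc m) one

  climbToSummit : ∀ v → Low v → ∃ λ w → v ~ w × Summit w
  climbToSummit v low = fold v climb (suc m) , proj₁ (~-climbs v low (suc m)) ,
    trans (D-climbs v (suc m)) (push-all (D v) one)

  -- All n differences of an edge between two summits are 1, of doubled weight 2n in total, which is
  -- below nk exactly because k > 2.
  summit-Low : ∀ v → Summit v → Low v
  summit-Low v summit = ≤-<-trans (≤-reflexive (trans (cong (λ t → 2 + weight t) summit) (weight-ones (suc m)))) (*-monoʳ-< n 2<k)
    where
    weight-ones : ∀ r → 2 + weight (replicate r one) ≡ suc r * 2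
    weight-ones zero    = refl
    weight-ones (suc r) = cong (2 +_) (weight-ones r)

  climb-Summit : ∀ v → Summit v → Summit (climb v)
  climb-Summit v summit = trans (D-climb v) (trans (cong (push one) summit) (push-replicate (suc m) one))

  head-climb : ∀ v → Summit v → head (climb v) ≡ head v ⊕ one
  head-climb (x ∷ y ∷ v) summit = trans (sym (⊖-⊕ y x)) (trans (⊕-comm (y ⊖ x) x) (cong (x ⊕_) (∷-injectiveˡ summit)))

  climbs-Summit : ∀ v → Summit v → ∀ i → Summit (fold v climb i) × head (fold v climb i) ≡ fold (head v) (_⊕ one) i
  climbs-Summit v summit zero    = summit , refl
  climbs-Summit v summit (suc i) = let summit′ , eq = climbs-Summit v summit i in
    climb-Summit (fold v climb i) summit′ , trans (head-climb (fold v climb i) summit′) (cong (_⊕ one) eq)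

  successors : ∀ (x : Fin k) i → fold x (_⊕ one) i ≡ (toℕ x + i) mod k
  successors x zero    = sym (trans (cong (_mod k) (+-identityʳ (toℕ x))) (mod-toℕ x))
  successors x (suc i) = trans (cong (_⊕ one) (successors x i)) (mod-cong (toℕ ((toℕ x + i) mod k) + 1) (toℕ x + suc i) k (begin
    (toℕ ((toℕ x + i) mod k) + 1) % k ≡⟨ cong (λ a → (a + 1) % k) (toℕ-mod (toℕ x + i) k) ⟩
    ((toℕ x + i) % k + 1) % k         ≡⟨ %-absorbˡ (toℕ x + i) 1 k ⟩
    (toℕ x + i + 1) % k               ≡⟨ cong (_% k) (trans (+-comm (toℕ x + i) 1) (sym (+-suc (toℕ x) i))) ⟩
    (toℕ x + suc i) % k               ∎))
    where open ≡-Reasoning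

  reachable : ∀ (x y : Fin k) → ∃ λ i → fold x (_⊕ one) i ≡ y
  -- From x it takes k - x steps to 0 and y more to y.
  reachable x y = k ∸ toℕ x + toℕ y , trans (successors x (k ∸ toℕ x + toℕ y))
    (trans (mod-cong (toℕ x + (k ∸ toℕ x + toℕ y)) (toℕ y) k (begin
      (toℕ x + (k ∸ toℕ x + toℕ y)) % k ≡⟨ cong (_% k) (+-assoc (toℕ x) (k ∸ toℕ x) (toℕ y)) ⟨
      (toℕ x + (k ∸ toℕ x) + toℕ y) % k ≡⟨ cong (λ a → (a + toℕ y) % k) (m+[n∸m]≡n (<⇒≤ (toℕ<n x))) ⟩
      (k + toℕ y) % k                   ≡⟨ cong (_% k) (+-comm k (toℕ y)) ⟩
      (toℕ y + k) % k                   ≡⟨ [m+n]%n≡m%n (toℕ y) k ⟩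
      toℕ y % k                         ∎)) (mod-toℕ y))
    where open ≡-Reasoning

  -- A summit is determined by its first entry, and a climb from a summit raises that entry by 1, so
  -- repeated climbs from one summit pass through all of them.
  summits : ∀ v w → Summit v → Summit w → v ~ w
  summits v w v-top w-top with reachable (head v) (head w)
  ... | i , eq = subst (v ~_) same (proj₁ (~-climbs v (summit-Low v v-top) i))
    where
    same : fold v climb i ≡ w
    same = let top , heads = climbs-Summit v v-top i in D-injective _ w (trans heads eq) (trans top (sym w-top))

  weight-tail : ∀ (e : Tuple k (suc n)) → doubleWeight (head (D e)) + weight (D (tail e)) ≡ weight (D e)
  weight-tail e = trans (cong (λ t → doubleWeight (head (D e)) + weight t) (sym (D-tail e))) (cong weight (head∷tail (D e)))

  nexts : Tuple k (suc n) → ℕ → Tuple k (suc n)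
  nexts e = fold e next

  D-nexts : ∀ e i → D (nexts e i) ≡ rotate i (D e)
  D-nexts e zero    = sym (rotate-zero (D e))
  D-nexts e (suc i) = begin
    D (next (nexts e i))                               ≡⟨ D-next (nexts e i) ⟩
    tail (D (nexts e i)) ∷ʳ head (D (nexts e i))       ≡⟨ rotate-one _ (tail (D (nexts e i))) ⟨
    rotate 1 (head (D (nexts e i)) ∷ tail (D (nexts e i))) ≡⟨ cong (rotate 1) (trans (head∷tail (D (nexts e i))) (D-nexts e i)) ⟩
    rotate 1 (rotate i (D e))                          ≡⟨ rotate-rotate i 1 (D e) ⟩
    rotate (i + 1) (D e)                               ≡⟨ cong (λ j → rotate j (D e)) (+-comm i 1) ⟩
    rotate (suc i) (D e)                               ∎
    where open ≡-Reasoning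

  nexts-chosen : ∀ e i → D e ∈ Chosen → D (nexts e i) ∈ Chosen
  nexts-chosen e i ∈C = rotation (D e) (D (nexts e i)) ∈C (i , sym (D-nexts e i))

  ~-nexts : ∀ e → D e ∈ Chosen → ∀ i → tail e ~ tail (nexts e i)
  ~-nexts e ∈C zero    = ε
  ~-nexts e ∈C (suc i) = ~-nexts e ∈C i ◅◅
    subst (_~ tail (next (nexts e i))) (init-∷ʳ _ (tail (nexts e i)))
      (along (next (nexts e i)) (inj₁ (case⇒F (chosen (nexts-chosen e (suc i) ∈C)))))

  -- Dropping the first difference must leave a total that is more than 2 below nk in doubled
  -- weight. For a light edge any first difference will do, since it weighs at least 2 and the total
  -- is already below nk. On a chosen circuit the total is exactly nk, so the dropped difference
  -- must weigh more than 2; an entry above average does, because k > 2.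
  reachLow : ∀ e → D e ∈ F choice → ∃ λ w → tail e ~ w × Low w
  reachLow e ∈F = byCase (F⇒case ∈F)
    where
    byCase : FCase (D e) → ∃ λ w → tail e ~ w × Low w
    byCase (light lt) = tail e , ε , (begin-strict
      2 + weight (D (tail e))                             ≤⟨ +-monoˡ-≤ _ (2≤doubleWeight (s≤s (s≤s z≤n)) (head (D e))) ⟩
      doubleWeight (head (D e)) + weight (D (tail e))     ≡⟨ weight-tail e ⟩
      weight (D e)                                        <⟨ lt ⟩
      n * k                                               ∎)
      where open ≤-Reasoning
    byCase (chosen ∈C) with heavyEntry (D e)
    ... | inj₂ (_ , self) = contradiction (self (Chosen-weight (D e) ∈C)) (proj₁ (sound (D e) ∈C))
    ... | inj₁ (j , heavy) = tail e′ , ~-nexts e ∈C (toℕ j) , (begin-strict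
      2 + weight (D (tail e′))                            <⟨ +-monoˡ-< _ (<-trans 2<k heavy′) ⟩
      doubleWeight (head (D e′)) + weight (D (tail e′))   ≡⟨ weight-tail e′ ⟩
      weight (D e′)                                       ≡⟨ Chosen-weight (D e′) (nexts-chosen e (toℕ j) ∈C) ⟩
      n * k                                               ∎)
      where
      open ≤-Reasoning
      e′ : Tuple k (suc n)
      e′ = nexts e (toℕ j)
      head-e′ : head (D e′) ≡ lookup (D e) j
      head-e′ = trans (cong head (D-nexts e (toℕ j))) (trans (head-window (suc m) (cyclic (D e)) (toℕ j)) (cong (lookup (D e)) (mod-toℕ j)))
      heavy′ : k < doubleWeight (head (D e′))
      heavy′ = subst (λ x → k < doubleWeight x) (sym head-e′) heavy

  -- The n - 1 differences have doubled weight (n - 1)k, and k > 2 leaves the room required.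
  selfNegative-Low : ∀ v → neg (D v) ≡ D v → Low v
  selfNegative-Low v self = ≤-<-trans (≤-reflexive (cong (2 +_) (selfNegative⇒weight (D v) self))) (+-monoˡ-< (suc m * k) 2<k)

  fromSource : ∀ e → ZCase e → ∃ λ w → init e ~ w × Low w
  fromTarget : ∀ e → ZCase e → ∃ λ w → tail e ~ w × Low w
  fromTarget e (off ∈F)           = reachLow e ∈F
  fromTarget _ (on x i pos lt)    = tail (onCircuit x i) , ε , selfNegative-Low (tail (onCircuit x i)) (begin
    neg (D (tail e))  ≡⟨ cong neg (D-tail e) ⟨
    neg (tail (D e))  ≡⟨ neg-tail (D e) ⟩
    tail (neg (D e))  ≡⟨ cong tail (D-onCircuit-negative x i) ⟩
    tail (D e)        ≡⟨ D-tail e ⟩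
    D (tail e)        ∎)
    where
    open ≡-Reasoning
    e : Tuple k (suc n)
    e = onCircuit x i
  fromSource e (off ∈F)           = let w , e~w , low = reachLow e ∈F in w , along e (inj₁ ∈F) ◅◅ e~w , low
  fromSource _ (on x i pos lt)    = init (onCircuit x i) , ε , selfNegative-Low (init (onCircuit x i)) (begin
    neg (D (init e))  ≡⟨ cong neg (D-init e) ⟨
    neg (init (D e))  ≡⟨ neg-init (D e) ⟩
    init (neg (D e))  ≡⟨ cong init (D-onCircuit-negative x i) ⟩
    init (D e)        ≡⟨ D-init e ⟩
    D (init e)        ∎)
    where
    open ≡-Reasoning
    e : Tuple k (suc n)
    e = onCircuit x i

  connectedVertices : ∀ u v → u ∈ Subgraph.V (edgeInduced Zᴱ) → v ∈ Subgraph.V (edgeInduced Zᴱ) → u ~ v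
  connectedVertices u v u∈ v∈ =
    let u′ , u~u′ , u-top = toSummit u u∈ ; v′ , v~v′ , v-top = toSummit v v∈ in
    u~u′ ◅◅ summits u′ v′ u-top v-top ◅◅ ~-sym v~v′
    where
    toSummit : ∀ u → u ∈ Subgraph.V (edgeInduced Zᴱ) → ∃ λ w → u ~ w × Summit w
    toSummit u (e , e∈ , inj₁ refl) = let w , u~w , low = fromSource e (Z⇒case e∈) ; t , w~t , top = climbToSummit w low in t , u~w ◅◅ w~t , top
    toSummit u (e , e∈ , inj₂ refl) = let w , u~w , low = fromTarget e (Z⇒case e∈) ; t , w~t , top = climbToSummit w low in t , u~w ◅◅ w~t , top

  eulerian : Eulerian (edgeInduced Zᴱ)
  eulerian = record
    { connected = connectedVertices
    ; balanced  = λ v _ → balanced succession v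
    }

-- The circuits b_x

neg-pointwise : ∀ {k r} {P : Pred (Fin k) 0ℓ} → (∀ {u} → P u ⇔ ⊝ u ≡ u) → {v : Tuple k r} → All P v ⇔ neg v ≡ v
neg-pointwise {P = P} P⇔ = mk⇔ collect spread
  where
  collect : ∀ {r} {v : Tuple _ r} → All P v → neg v ≡ v
  collect []       = refl
  collect (p ∷ ps) = cong₂ _∷_ (to P⇔ p) (collect ps)
  spread : ∀ {r} {v : Tuple _ r} → neg v ≡ v → All P v
  spread {v = []}    _  = []
  spread {v = x ∷ v} eq = from P⇔ (∷-injectiveˡ eq) ∷ spread (∷-injectiveʳ eq)

module EvenModulus (l : ℕ) (2∣k : 2 ∣ suc l) where

  open Residues l

  private
    k : ℕ
    k = suc l

    2*half : 2 * (k / 2) ≡ k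
    2*half = trans (*-comm 2 (k / 2)) (m/n*n≡m 2∣k)

  IsHalf : Pred (Fin k) 0ℓ
  IsHalf u = toℕ u ≡ 0 ⊎ toℕ u ≡ k / 2

  IsHalf⇔ : ∀ {u} → IsHalf u ⇔ ⊝ u ≡ u
  IsHalf⇔ = mk⇔ (λ u-half → doubleWeight≡k⇒selfNegative _ (toDouble _ u-half)) (λ eq → fromDouble _ (selfNegative⇒doubleWeight≡k _ eq))
    where
    toDouble : ∀ u → IsHalf u → doubleWeight u ≡ k
    toDouble Fin.zero    _         = refl
    toDouble (Fin.suc u) (inj₂ eq) = trans (cong (2 *_) eq) 2*half
    fromDouble : ∀ u → doubleWeight u ≡ k → IsHalf u
    fromDouble Fin.zero    _  = inj₁ refl
    fromDouble (Fin.suc u) eq = inj₂ (*-cancelˡ-≡ (toℕ (Fin.suc u)) (k / 2) 2 (trans eq (sym 2*half)))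

  middle : Fin k
  middle = Fin.fromℕ< (m/n<m k 2 ≤-refl)

  toℕ-middle : toℕ middle ≡ k / 2
  toℕ-middle = Fin.toℕ-fromℕ< (m/n<m k 2 ≤-refl)

  halves : List (Fin k)
  halves = Fin.zero ∷ middle ∷ []

  halves-unique : Unique halves
  halves-unique = (zero≢middle Allˡ.∷ Allˡ.[]) ∷ Allˡ.[] ∷ []
    where
    zero≢middle : Fin.zero ≢ middle
    zero≢middle eq = contradiction (trans (sym 2*half) (cong (2 *_) (trans (sym toℕ-middle) (cong toℕ (sym eq))))) λ ()

  ∈-halves⇔ : ∀ {u} → u ∈ˡ halves ⇔ IsHalf u
  ∈-halves⇔ = mk⇔ (λ { (here refl) → inj₁ refl ; (there (here refl)) → inj₂ toℕ-middle })
    (λ { (inj₁ eq) → here (toℕ-injective eq) ; (inj₂ eq) → there (here (toℕ-injective (trans eq (sym toℕ-middle)))) })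

  ∈-halves⇔selfNegative : ∀ {u} → u ∈ˡ halves ⇔ ⊝ u ≡ u
  ∈-halves⇔selfNegative = mk⇔ (λ u∈ → to IsHalf⇔ (to ∈-halves⇔ u∈)) (λ eq → from ∈-halves⇔ (from IsHalf⇔ eq))

  -- 2^r tuples begin with 0 and as many with k / 2.
  sum-heads : ∀ r → sum (List.map (λ v → toℕ (head v)) (tuples halves (suc r))) ≡ 2 ^ r * (k / 2)
  sum-heads r = begin
    sum (List.map toℕ-head (List.map (Fin.zero ∷_) vs ++ (List.map (middle ∷_) vs ++ [])))
      ≡⟨ cong sum (Listₚ.map-++ toℕ-head (List.map (Fin.zero ∷_) vs) _) ⟩
    sum (List.map toℕ-head (List.map (Fin.zero ∷_) vs) ++ List.map toℕ-head (List.map (middle ∷_) vs ++ []))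
      ≡⟨ sum-++ (List.map toℕ-head (List.map (Fin.zero ∷_) vs)) _ ⟩
    sum (List.map toℕ-head (List.map (Fin.zero ∷_) vs)) + sum (List.map toℕ-head (List.map (middle ∷_) vs ++ []))
      ≡⟨ cong₂ _+_ (constant Fin.zero vs) (trans (cong (λ ws → sum (List.map toℕ-head ws)) (Listₚ.++-identityʳ (List.map
          (middle ∷_) vs))) (constant middle vs)) ⟩
    length vs * 0 + length vs * toℕ middle
      ≡⟨ cong₂ _+_ (*-zeroʳ (length vs)) (cong₂ _*_ (length-tuples halves r) toℕ-middle) ⟩
    2 ^ r * (k / 2) ∎
    where
    open ≡-Reasoning
    vs : List (Tuple k r)
    vs = tuples halves r
    toℕ-head : Tuple k (suc r) → ℕ
    toℕ-head v = toℕ (head v)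
    constant : ∀ x ws → sum (List.map toℕ-head (List.map (x ∷_) ws)) ≡ length ws * toℕ x
    constant x []       = refl
    constant x (w ∷ ws) = cong (toℕ x +_) (constant x ws)

partialSum-sum : ∀ {l} (s : ℕ → Fin (suc l)) i → toℕ (partialSum s i) ≡ sum (applyUpTo (λ j → toℕ (s j)) (suc i)) % suc l
partialSum-sum {l} s zero    = sym (trans (cong (_% suc l) (+-identityʳ (toℕ (s 0)))) (m<n⇒m%n≡m (toℕ<n (s 0))))
partialSum-sum {l} s (suc i) = begin
  toℕ (partialSum s i ⊕ s (suc i))                          ≡⟨ Residues.toℕ-⊕ l (partialSum s i) (s (suc i)) ⟩
  (toℕ (partialSum s i) + toℕ (s (suc i))) % suc l          ≡⟨ cong (λ a → (a + toℕ (s (suc i))) % suc l) (partialSum-sum s i) ⟩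
  (total (suc i) % suc l + toℕ (s (suc i))) % suc l         ≡⟨ %-absorbˡ (total (suc i)) (toℕ (s (suc i))) (suc l) ⟩
  (total (suc i) + toℕ (s (suc i))) % suc l                 ≡⟨ cong (_% suc l) (sym snoc) ⟩
  total (suc (suc i)) % suc l                               ∎
  where
  open ≡-Reasoning
  values : ℕ → ℕ
  values j = toℕ (s j)
  total : ℕ → ℕ
  total j = sum (applyUpTo values j)
  snoc : total (suc (suc i)) ≡ total (suc i) + toℕ (s (suc i))
  snoc = trans (cong sum (sym (Listₚ.applyUpTo-∷ʳ values (suc i)))) (trans (sum-++ (applyUpTo values (suc i)) _) (cong
      (total (suc i) +_) (+-identityʳ _)))

module EvenCircuits (l m : ℕ) (2∣k : 2 ∣ suc l) (a : Tuple (suc l) (2 ^ (2 + m)))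
                    (isCircuit : IsEulerianCircuit (T (suc l) (suc m)) {{m^n≢0 2 (2 + m)}} a) where

  open Residues l
  open Differences l
  open EvenModulus l 2∣k
  open IsEulerianCircuit {{m^n≢0 2 (2 + m)}} isCircuit

  private
    k n N : ℕ
    k = suc l
    n = 2 + m
    N = 2 ^ n

    instance
      N≢0 : NonZero N
      N≢0 = m^n≢0 2 n

    s : ℕ → Fin k
    s = cyclic a

    c : ℕ → Fin k
    c = partialSum s

    s-cong : ∀ i j → i % N ≡ j % N → s i ≡ s j
    s-cong = cyclic-cong a

    window-s-cong : ∀ i j → i % N ≡ j % N → window n s i ≡ window n s j
    window-s-cong i j eq = window-cong n s s i j λ x → s-cong (i + x) (j + x) (begin
      (i + x) % N     ≡⟨ %-absorbˡ i x N ⟨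
      (i % N + x) % N ≡⟨ cong (λ r → (r + x) % N) eq ⟩
      (j % N + x) % N ≡⟨ %-absorbˡ j x N ⟩
      (j + x) % N     ∎)
      where open ≡-Reasoning

    window-s-injective : ∀ i j → window n s i ≡ window n s j → i % N ≡ j % N
    window-s-injective i j eq with once (window n s i) (edges i)
    ... | x , _ , unique = begin
      i % N         ≡⟨ toℕ-mod i N ⟨
      toℕ (i mod N) ≡⟨ cong toℕ (unique (window-s-cong (toℕ (i mod N)) i (reduced i))) ⟨
      toℕ x         ≡⟨ cong toℕ (unique (trans (window-s-cong (toℕ (j mod N)) j (reduced j)) (sym eq))) ⟩
      toℕ (j mod N) ≡⟨ toℕ-mod j N ⟩
      j % N         ∎
      where
      open ≡-Reasoning
      reduced : ∀ i → toℕ (i mod N) % N ≡ i % N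
      reduced i = trans (cong (_% N) (toℕ-mod i N)) (m%n%n≡m%n i N)

    s-negative : ∀ i → ⊝ (s i) ≡ s i
    s-negative i = to IsHalf⇔ (subst IsHalf (head-window (suc m) s i) (Allᵛ.head (edges i)))

    c-negative : ∀ i → ⊝ (c i) ≡ c i
    c-negative zero    = s-negative 0
    c-negative (suc i) = trans (sym (⊝-⊕-comm (c i) (s (suc i)))) (cong₂ _⊕_ (c-negative i) (s-negative (suc i)))

    windows : List (Tuple k n)
    windows = applyUpTo (window n s) N

    -- This replaces the sum of the entries along the circuit, whatever Eulerian circuit was fixed,
    -- by a sum over all tuples over {0, k/2}.
    windows↭ : windows ↭ tuples halves n
    windows↭ = sameElements⇒↭
      (Unique.applyUpTo⁺₁ (window n s) N λ {i} {j} i<j j<N eq → <-irrefl (trans (sym (m<n⇒m%n≡m (<-trans i<j j<N)))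
          (trans (window-s-injective i j eq) (m<n⇒m%n≡m j<N))) i<j)
      (tuples-unique halves-unique n)
      (mk⇔ into onto)
      where
      into : ∀ {t} → t ∈ˡ windows → t ∈ˡ tuples halves n
      into t∈ with ∈-applyUpTo⁻ (window n s) t∈
      ... | i , _ , refl = ∈-tuples⁺ halves (Allᵛ.map (from ∈-halves⇔) (edges i))
      onto : ∀ {t} → t ∈ˡ tuples halves n → t ∈ˡ windows
      onto {t} t∈ with once t (Allᵛ.map (to ∈-halves⇔) (∈-tuples⁻ halves t∈))
      ... | i , refl , _ = ∈-applyUpTo⁺ (window n s) (toℕ<n i)

    -- The sum of all entries is 2^(n-1) (k / 2), a multiple of k as n ≥ 2.
    total-entries : sum (applyUpTo (λ j → toℕ (s j)) N) ≡ 2 ^ m * k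
    total-entries = begin
      sum (applyUpTo (λ j → toℕ (s j)) N)                      ≡⟨ cong sum (sym heads) ⟩
      sum (List.map (λ v → toℕ (head v)) windows)              ≡⟨ sum-↭ (↭-map⁺ _ windows↭) ⟩
      sum (List.map (λ v → toℕ (head v)) (tuples halves n))    ≡⟨ sum-heads (suc m) ⟩
      2 * 2 ^ m * (k / 2)                                      ≡⟨ cong (_* (k / 2)) (*-comm 2 (2 ^ m)) ⟩
      2 ^ m * 2 * (k / 2)                                      ≡⟨ *-assoc (2 ^ m) 2 (k / 2) ⟩
      2 ^ m * (2 * (k / 2))                                    ≡⟨ cong (2 ^ m *_) (trans (*-comm 2 (k / 2)) (m/n*n≡m 2∣k)) ⟩
      2 ^ m * k                                                ∎
      where
      open ≡-Reasoning
      heads : List.map (λ v → toℕ (head v)) windows ≡ applyUpTo (λ j → toℕ (s j)) N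
      heads = trans (Listₚ.map-applyUpTo (window n s) (λ v → toℕ (head v)) N) (applyUpTo-cong N λ j → cong toℕ (head-window (suc m) s j))
        where
        applyUpTo-cong : ∀ {g h : ℕ → ℕ} N → (∀ j → g j ≡ h j) → applyUpTo g N ≡ applyUpTo h N
        applyUpTo-cong zero    eq = refl
        applyUpTo-cong (suc N) eq = cong₂ _∷_ (eq 0) (applyUpTo-cong N (eq ∘ suc))

    suc-pred-N : suc (pred N) ≡ N
    suc-pred-N = suc-pred N

    c-last : c (pred N) ≡ Fin.zero
    c-last = toℕ-injective (begin
      toℕ (c (pred N))                                       ≡⟨ partialSum-sum s (pred N) ⟩
      sum (applyUpTo (λ j → toℕ (s j)) (suc (pred N))) % k   ≡⟨ cong (λ d → sum (applyUpTo (λ j → toℕ (s j)) d) % k) suc-pred-N ⟩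
      sum (applyUpTo (λ j → toℕ (s j)) N) % k                ≡⟨ cong (_% k) total-entries ⟩
      (2 ^ m * k) % k                                        ≡⟨ m*n%n≡0 (2 ^ m) k ⟩
      0                                                      ∎)
      where open ≡-Reasoning

    c-periodic : ∀ i → c (i + suc (pred N)) ≡ c i
    c-periodic zero    = trans (cong (_⊕ s (suc (pred N))) c-last) (trans (⊕-identityˡ _)
      (s-cong (suc (pred N)) 0 (trans (cong (_% N) suc-pred-N) (trans (n%n≡0 N) (sym (0%n N))))))
      where
      0%n : ∀ N .{{_ : NonZero N}} → 0 % N ≡ 0
      0%n N = m<n⇒m%n≡m (>-nonZero⁻¹ N)
    c-periodic (suc i) = cong₂ _⊕_ (c-periodic i) (s-cong (suc i + suc (pred N)) (suc i)
      (trans (cong (λ d → (suc i + d) % N) suc-pred-N) ([m+n]%n≡m%n (suc i) N)))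

    c-multiple : ∀ r q → c (r + q * N) ≡ c r
    c-multiple r zero    = cong c (+-identityʳ r)
    c-multiple r (suc q) = trans (cong c (trans (cong (r +_) (+-comm N (q * N))) (trans (sym (+-assoc r (q * N) N))
        (cong ((r + q * N) +_) (sym suc-pred-N)))))
      (trans (c-periodic (r + q * N)) (c-multiple r q))

    c-mod : ∀ i → c i ≡ c (i % N)
    c-mod i = trans (cong c (m≡m%n+[m/n]*n i N)) (c-multiple (i % N) (i / N))

    D-c : ∀ i → D (window (suc n) c i) ≡ window n s (suc i)
    D-c i = trans (D-window n c i) (window-cong n (λ x → c (suc x) ⊖ c x) s i (suc i) λ x → ⊕-⊖ˡ (c (i + x)) (s (suc (i + x))))

  evenCircuits : CircuitFamily k (suc m) (b (even 2∣k a isCircuit))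
  evenCircuits = record
    { c           = c
    ; pred-period = pred N
    ; periodic    = c-periodic
    ; c-negative  = c-negative
    ; member      = λ x e → mk⇔ (λ (i , eq) → i , trans (sym (reading x i)) eq) (λ (i , eq) → i , trans (reading x i) eq)
    ; locate      = locate
    ; separate    = separate
    }
    where
    reading : ∀ x i → window (suc n) (cyclic (tabulate {n = N} λ j → x ⊕ c (toℕ j))) i ≡ window (suc n) (λ j → x ⊕ c j) i
    reading x i = window-cong (suc n) (cyclic (tabulate {n = N} λ j → x ⊕ c (toℕ j))) (λ j → x ⊕ c j) i i λ y →
      trans (cyclic-tabulate (λ j → x ⊕ c j) (i + y)) (cong (x ⊕_) (sym (c-mod (i + y))))
    locate : ∀ t → neg t ≡ t → ∃ λ i → D (window (suc n) c i) ≡ t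
    locate t self with once t (from (neg-pointwise IsHalf⇔) self)
    -- By `D-c` the differences of `c` from `i` on are the entries of `s` from `i + 1` on; adding
    -- `pred N` goes one place back modulo `N`.
    ... | i , eq , _ = pred N + toℕ i , trans (D-c (pred N + toℕ i)) (trans (window-s-cong (suc (pred N + toℕ i)) (toℕ i) (begin
      (suc (pred N) + toℕ i) % N ≡⟨ cong (λ d → (d + toℕ i) % N) suc-pred-N ⟩
      (N + toℕ i) % N            ≡⟨ cong (_% N) (+-comm N (toℕ i)) ⟩
      (toℕ i + N) % N            ≡⟨ [m+n]%n≡m%n (toℕ i) N ⟩
      toℕ i % N                  ∎)) eq)
      where open ≡-Reasoning
    separate : ∀ i j → D (window (suc n) c i) ≡ D (window (suc n) c j) → ∀ d → c (i + d) ≡ c (j + d)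
    -- Equal windows of `s` determine `suc i` modulo `N`, so a full period is added to rewrite
    -- `i + d` in terms of `suc i`.
    separate i j eq d = begin
      c (i + d)                       ≡⟨ shifted i ⟩
      c ((suc i + (pred N + d)) % N)  ≡⟨ cong c (trans (sym (%-absorbˡ (suc i) (pred N + d) N)) (trans (cong (λ r → (r +
          (pred N + d)) % N) same) (%-absorbˡ (suc j) (pred N + d) N))) ⟩
      c ((suc j + (pred N + d)) % N)  ≡⟨ shifted j ⟨
      c (j + d)                       ∎
      where
      open ≡-Reasoning
      same : suc i % N ≡ suc j % N
      same = window-s-injective (suc i) (suc j) (trans (sym (D-c i)) (trans eq (D-c j)))
      regroup : ∀ i p d → i + d + suc p ≡ suc i + (p + d)
      regroup = solve-∀
      shifted : ∀ i → c (i + d) ≡ c ((suc i + (pred N + d)) % N)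
      shifted i = trans (sym (c-periodic (i + d))) (trans (cong c (regroup i (pred N) d)) (c-mod (suc i + (pred N + d))))

module OddModulus (l : ℕ) (k-odd : ¬ 2 ∣ suc l) where

  open Residues l

  selfNegative⇒zero : ∀ (u : Fin (suc l)) → ⊝ u ≡ u → u ≡ Fin.zero
  selfNegative⇒zero Fin.zero    _  = refl
  selfNegative⇒zero (Fin.suc u) eq = contradiction
    (divides (suc (toℕ u)) (trans (sym (selfNegative⇒doubleWeight≡k (Fin.suc u) eq)) (*-comm 2 (suc (toℕ u))))) k-odd

  selfNegative⇒replicate : ∀ {r} (v : Tuple (suc l) r) → neg v ≡ v → v ≡ replicate r Fin.zero
  selfNegative⇒replicate []      _  = refl
  selfNegative⇒replicate (x ∷ v) eq = cong₂ _∷_ (selfNegative⇒zero x (∷-injectiveˡ eq)) (selfNegative⇒replicate v (∷-injectiveʳ eq))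

  -- For odd `k` the only self-negative residue is 0. The common sequence is therefore constantly 0,
  -- of period 1, and its translates are the loops.
  oddCircuits : ∀ m → CircuitFamily (suc l) m (b (odd k-odd))
  oddCircuits m = record
    { c           = λ _ → Fin.zero
    ; pred-period = 0
    ; periodic    = λ _ → refl
    ; c-negative  = λ _ → ⊝-zero
    ; member      = λ x e → mk⇔ (λ eq → 0 , trans (constant x) (sym eq)) (λ (i , eq) → trans (sym eq) (constant x))
    ; locate      = λ t self → 0 , trans (selfNegative⇒replicate _ flat) (sym (selfNegative⇒replicate t self))
    ; separate    = λ _ _ _ _ → refl
    }
    where
    open Differences l
    constant : ∀ x → tabulate {n = 2 + m} (λ _ → x ⊕ Fin.zero) ≡ replicate (2 + m) x
    constant x = trans (tabulate-constant (2 + m) (x ⊕ Fin.zero)) (cong (replicate (2 + m)) (⊕-identityʳ x))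
    zeros : Tuple (suc l) (2 + m)
    zeros = tabulate λ _ → Fin.zero
    flat : neg (D zeros) ≡ D zeros
    flat = trans (sym (D-neg zeros)) (cong D (trans (sym (tabulate-∘ ⊝_ λ _ → Fin.zero)) (tabulate-cong λ _ → ⊝-zero)))

-- The choices in the construction of Z

argmin : ∀ (h : ℕ → ℕ) N → ∃ λ i → ∀ j → j ≤ N → h i ≤ h j
argmin h zero    = 0 , λ { zero z≤n → ≤-refl }
argmin h (suc N) with argmin h N
... | i , min with ≤-total (h i) (h (suc N))
... | inj₁ i≤ = i , λ j j≤ → [ (λ j< → min j (s≤s⁻¹ j<)) , (λ { refl → i≤ }) ]′ (m≤n⇒m<n∨m≡n j≤)
... | inj₂ N≤ = suc N , λ j j≤ → [ (λ j< → ≤-trans N≤ (min j (s≤s⁻¹ j<))) , (λ { refl → ≤-refl }) ]′ (m≤n⇒m<n∨m≡n j≤)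

odd⇒1+2q : ∀ n → ¬ 2 ∣ n → ∃ λ q → n ≡ suc (q * 2)
odd⇒1+2q n n-odd with n % 2 in eq | m%n<n n 2 | m≡m%n+[m/n]*n n 2
... | 0 | _ | _    = contradiction (m%n≡0⇒n∣m n 2 eq) n-odd
... | 1 | _ | div  = n / 2 , div
... | suc (suc _) | s≤s (s≤s ()) | _

module ChoiceExists (l m : ℕ) (n-odd : ¬ 2 ∣ suc m) where

  open Residues l
  open Differences l

  private
    k n : ℕ
    k = suc l
    n = suc m

  -- The tuple read as a number in base k, first entry least significant: an injective ranking by
  -- which two circuits can be compared.
  code : ∀ {r} → Tuple k r → ℕ
  code []      = 0
  code (x ∷ v) = toℕ x + code v * k

  code-injective : ∀ {r} (u v : Tuple k r) → code u ≡ code v → u ≡ v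
  code-injective []      []      _  = refl
  code-injective (x ∷ u) (y ∷ v) eq = cong₂ _∷_ (toℕ-injective x≡y) (code-injective u v
      (*-cancelʳ-≡ (code u) (code v) k (+-cancelˡ-≡ (toℕ x) (code u * k) (code v * k) (trans eq (cong (_+ code v * k) (sym x≡y))))))
    where
    residue : ∀ {r} x (v : Tuple k r) → (toℕ x + code v * k) % k ≡ toℕ x
    residue x v = trans ([m+kn]%n≡m%n (toℕ x) (code v) k) (m<n⇒m%n≡m (toℕ<n x))
    x≡y : toℕ x ≡ toℕ y
    x≡y = trans (sym (residue x u)) (trans (cong (_% k) eq) (residue y v))

  -- Least by `code`; the pseudoweight is the same for all rotations. Indices matter modulo n, so a
  -- minimum over 0, ..., m is a minimum over all.
  lightestRotation : ∀ a → ∃ λ i → ∀ j → code (rotate i a) ≤ code (rotate {m = m} j a)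
  lightestRotation a with argmin (λ i → code (rotate i a)) m
  ... | i , min = i , λ j → subst (λ b → code (rotate i a) ≤ code b)
    (rotate-cong (j % n) j a (m%n%n≡m%n j n)) (min (j % n) (s≤s⁻¹ (m%n<n j n)))

  -- As i + m i is a multiple of n = m + 1, rotating by `m * i` undoes rotating by `i`, with no
  -- subtraction.
  rotate-back : ∀ i j (a : Tuple k n) → rotate (m * i + j) (rotate i a) ≡ rotate j a
  rotate-back i j a = trans (rotate-rotate i (m * i + j) a) (rotate-cong (i + (m * i + j)) j a (begin
    (i + (m * i + j)) % n ≡⟨ cong (_% n) (regroup i m j) ⟩
    (j + i * n) % n       ≡⟨ [m+kn]%n≡m%n j i n ⟩
    j % n                 ∎))
    where
    open ≡-Reasoning
    regroup : ∀ i m j → i + (m * i + j) ≡ j + i * (1 + m)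
    regroup = solve-∀

  rotate-undo : ∀ i (a : Tuple k n) → rotate (m * i) (rotate i a) ≡ a
  rotate-undo i a = trans (cong (λ d → rotate d (rotate i a)) (sym (+-identityʳ (m * i)))) (trans (rotate-back i 0 a) (rotate-zero a))

  -- Rotation by d is an operator of odd order, so it cannot negate a tuple
  -- unless the tuple is self-negative.
  rotate≡neg : ∀ d (a : Tuple k n) → rotate d a ≡ neg a → neg a ≡ a
  rotate≡neg d a eq with odd⇒1+2q n n-odd
  ... | q , n≡ = sym (begin
      a                              ≡⟨ rotate-multiple d a ⟨
      rotate (d * n) a               ≡⟨ cong (λ e → rotate e a) (trans (cong (d *_) n≡) (regroup d q)) ⟩
      rotate (d + q * (d + d)) a     ≡⟨ rotate-rotate d (q * (d + d)) a ⟨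
      rotate (q * (d + d)) (rotate d a) ≡⟨ cong (rotate (q * (d + d))) eq ⟩
      rotate (q * (d + d)) (neg a)   ≡⟨ neg-rotate (q * (d + d)) a ⟨
      neg (rotate (q * (d + d)) a)   ≡⟨ cong neg (evenTurns q) ⟩
      neg a                          ∎)
    where
    open ≡-Reasoning
    regroup : ∀ d q → d * (1 + q * 2) ≡ d + q * (d + d)
    regroup = solve-∀
    twice : rotate (d + d) a ≡ a
    twice = begin
      rotate (d + d) a      ≡⟨ rotate-rotate d d a ⟨
      rotate d (rotate d a) ≡⟨ cong (rotate d) eq ⟩
      rotate d (neg a)      ≡⟨ neg-rotate d a ⟨
      neg (rotate d a)      ≡⟨ cong neg eq ⟩
      neg (neg a)           ≡⟨ neg-involutive a ⟩
      a                     ∎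
    evenTurns : ∀ q → rotate (q * (d + d)) a ≡ a
    evenTurns zero    = rotate-zero a
    evenTurns (suc q) = trans (sym (rotate-rotate (d + d) (q * (d + d)) a)) (trans (cong (rotate (q * (d + d))) twice) (evenTurns q))

  -- A tuple common to [a] and [-a] makes -a a rotation of a. Hence for a non-self-negative circuit
  -- the least codes on the two sides never tie, and comparing them always makes a choice.
  commonRotation⇒selfNegative : ∀ i j (a : Tuple k n) → rotate i a ≡ rotate j (neg a) → neg a ≡ a
  commonRotation⇒selfNegative i j a eq = rotate≡neg (j + m * i) a (begin
    rotate (j + m * i) a                  ≡⟨ neg-involutive (rotate (j + m * i) a) ⟨
    neg (neg (rotate (j + m * i) a))      ≡⟨ cong neg (neg-rotate (j + m * i) a) ⟩
    neg (rotate (j + m * i) (neg a))      ≡⟨ cong neg (rotate-rotate j (m * i) (neg a)) ⟨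
    neg (rotate (m * i) (rotate j (neg a))) ≡⟨ cong (λ b → neg (rotate (m * i) b)) eq ⟨
    neg (rotate (m * i) (rotate i a))     ≡⟨ cong neg (rotate-undo i a) ⟩
    neg a                                 ∎)
    where open ≡-Reasoning

  weight-rotate : ∀ i (a : Tuple k n) → weight (rotate i a) ≡ weight a
  weight-rotate zero    a       = cong weight (rotate-zero a)
  weight-rotate (suc i) (x ∷ v) = begin
    weight (rotate (suc i) (x ∷ v))         ≡⟨ cong weight (rotate-rotate 1 i (x ∷ v)) ⟨
    weight (rotate i (rotate 1 (x ∷ v)))    ≡⟨ weight-rotate i (rotate 1 (x ∷ v)) ⟩
    weight (rotate 1 (x ∷ v))               ≡⟨ cong weight (rotate-one x v) ⟩
    weight (v ∷ʳ x)                         ≡⟨ weight-∷ʳ v x ⟩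
    weight (x ∷ v)                          ∎
    where open ≡-Reasoning

  C*-weight : ∀ {a} b → a ∈ C* k n → neg b ≢ b → weight b ≡ weight a → b ∈ C* k n
  C*-weight {a} b (_ , w) b≢ eq = b≢ , trans (w*≡half b) (trans (cong half eq) (trans (sym (w*≡half a)) w))

  rotate-C* : ∀ i a → a ∈ C* k n → rotate i a ∈ C* k n
  rotate-C* i a a∈ = C*-weight {a} (rotate i a) a∈ (λ eq → proj₁ a∈ (begin
    neg a                                  ≡⟨ rotate-undo i (neg a) ⟨
    rotate (m * i) (rotate i (neg a))      ≡⟨ cong (rotate (m * i)) (neg-rotate i a) ⟨
    rotate (m * i) (neg (rotate i a))      ≡⟨ cong (rotate (m * i)) eq ⟩
    rotate (m * i) (rotate i a)            ≡⟨ rotate-undo i a ⟩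
    a                                      ∎)) (weight-rotate i a)
    where open ≡-Reasoning

  neg-C* : ∀ a → a ∈ C* k n → neg a ∈ C* k n
  neg-C* a a∈@(a≢ , w) = C*-weight {a} (neg a) a∈ (λ eq → a≢ (trans (sym eq) (neg-involutive a)))
    (+-cancelʳ-≡ (weight a) (weight (neg a)) (weight a) (trans (weight-neg a) (trans (cong (n * k +_) (+-identityʳ
        (n * k))) (cong₂ _+_ (sym a-weight) (sym a-weight)))))
    where
    a-weight : weight a ≡ n * k
    a-weight = trans (half-injective (trans (sym (w*≡half a)) w)) (*-comm k n)

  -- Of the circuits [ a ] and [ neg a ], choose the one containing the tuple
  -- of least code.
  circuitChoice : CircuitChoice k m
  circuitChoice = record
    { Chosen   = λ a → a ∈ C* k n × ∃ λ i → ∀ j → code (rotate i a) < code (rotate j (neg a))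
    ; rotation = λ { a _ (a∈ , i , isLeast) (q , refl) → rotate-C* q a a∈ , m * q + i , λ j →
        subst₂ _<_ (cong code (sym (rotate-back q i a)))
                   (cong code (trans (sym (rotate-rotate q j (neg a))) (cong (rotate j) (sym (neg-rotate q a)))))
                   (isLeast (q + j)) }
    ; sound    = λ _ → proj₁
    ; atLeast  = choose
    ; atMost   = λ { a (_ , i , isLeast) (_ , j , isLeast′) → <-asym (isLeast j)
        (subst (λ b → code (rotate j (neg a)) < code (rotate i b)) (neg-involutive a) (isLeast′ i)) }
    }
    where
    choose : ∀ a → a ∈ C* k n → _ ⊎ _
    choose a a∈ with lightestRotation a | lightestRotation (neg a)
    ... | i , min | j , min′ with <-cmp (code (rotate i a)) (code (rotate j (neg a)))
    ... | tri< lt _ _ = inj₁ (a∈ , i , λ j′ → <-≤-trans lt (min′ j′))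
    ... | tri≈ _ eq _ = contradiction (commonRotation⇒selfNegative i j a (code-injective _ _ eq)) (proj₁ a∈)
    ... | tri> _ _ gt = inj₂ (neg-C* a a∈ , j , λ i′ →
        <-≤-trans gt (subst (λ b → code (rotate i a) ≤ code (rotate i′ b)) (sym (neg-involutive a)) (min i′)))

-- An Eulerian circuit over {0, k/2}

module _ {A : Set} {P : Pred A 0ℓ} where

  All-∷ʳ : ∀ {r} {v : Vec A r} {x} → All P v → P x → All P (v ∷ʳ x)
  All-∷ʳ []       px = px ∷ []
  All-∷ʳ (p ∷ ps) px = p ∷ All-∷ʳ ps px

  All-push : ∀ {r} {v : Vec A r} {x} → All P v → P x → All P (push x v)
  All-push []       px = []
  All-push (p ∷ ps) px = All-∷ʳ ps px

  All-init : ∀ {r} {v : Vec A (suc r)} → All P v → All P (init v)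
  All-init {v = x ∷ []}    (p ∷ [])     = []
  All-init {v = x ∷ y ∷ v} (p ∷ ps)     = p ∷ All-init ps

  All-last : ∀ {r} {v : Vec A (suc r)} → All P v → P (last v)
  All-last {v = x ∷ []}    (p ∷ [])     = p
  All-last {v = x ∷ y ∷ v} (p ∷ ps)     = All-last ps

module BinaryCircuit (l m : ℕ) (2∣k : 2 ∣ suc l) where

  open Residues l
  open EvenModulus l 2∣k

  private
    k n N : ℕ
    k = suc l
    n = suc m
    N = 2 ^ n

    instance
      N≢0 : NonZero N
      N≢0 = m^n≢0 2 n

  -- A tuple over {0, k/2} is followed by its own rotation. The circuit presupposed for even `k`
  -- thus comes from the same theorem that is applied to Z.
  rotation : Succession {k} {m} (All IsHalf)
  rotation = record
    { E?   = Allᵛ.all? λ u → toℕ u ≟ 0 ⊎-dec toℕ u ≟ k / 2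
    ; φ    = λ e → tail e ∷ʳ head e
    ; ψ    = λ e → last e ∷ init e
    ; φ-∈  = λ { (p ∷ ps) → All-∷ʳ ps p }
    ; ψ-∈  = λ ps → All-last ps ∷ All-init ps
    ; ψ-φ  = λ { {x ∷ v} _ → cong₂ _∷_ (last-∷ʳ x v) (init-∷ʳ x v) }
    ; φ-ψ  = λ {e} _ → sym (init-∷ʳ-last e)
    ; walk = λ { {x ∷ v} _ → init-∷ʳ x v }
    }

  _~_ : Tuple k m → Tuple k m → Set
  _~_ = EqClosure (Adjacent (T k m))

  ~-zero : ∀ u → All IsHalf u → u ~ replicate m Fin.zero
  ~-zero u u-half = subst (u ~_) (push-all u Fin.zero) (proj₁ (pushes m))
    where
    pushes : ∀ i → u ~ fold u (push Fin.zero) i × All IsHalf (fold u (push Fin.zero) i)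
    pushes zero    = ε , u-half
    pushes (suc i) = let w , w-half = pushes i ; v = fold u (push Fin.zero) i in
      w ◅◅ fwd (v ∷ʳ Fin.zero , All-∷ʳ w-half (inj₁ refl) , init-∷ʳ Fin.zero v , refl) ◅ ε ,
      All-push w-half (inj₁ refl)

  eulerianCircuit : ∃ λ (a : Tuple k N) → IsEulerianCircuit (T k m) a
  eulerianCircuit = fromSequence (eulerianSequence rotation
      (replicate n Fin.zero , zeros n)
      (λ {e} {e′} e∈ e′∈ → ~-zero (init e) (All-init e∈) ◅◅ EqClosure.symmetric _ (~-zero (init e′) (All-init e′∈))))
    where
    zeros : ∀ r → All IsHalf (replicate r Fin.zero)
    zeros zero    = []
    zeros (suc r) = inj₁ refl ∷ zeros r

    size : length (edgeList rotation) ≡ N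
    size = trans (↭-length (sameElements⇒↭ (edgeList-unique rotation) (tuples-unique halves-unique n)
        (mk⇔ (λ e∈ → ∈-tuples⁺ halves (Allᵛ.map (from ∈-halves⇔) (to (∈-edgeList rotation) e∈)))
             (λ e∈ → from (∈-edgeList rotation) (Allᵛ.map (to ∈-halves⇔) (∈-tuples⁻ halves e∈))))))
      (length-tuples halves n)

    fromSequence : ∃ (IsEulerianSequence rotation) → ∃ λ (a : Tuple k N) → IsEulerianCircuit (T k m) a
    fromSequence (s , isWindow , occurs) = a , record { edges = inT ; once = once }
      where
      open IsWindowSequence (subst (IsWindowSequence k n s) size isWindow)
      a : Tuple k N
      a = tabulate (s ∘ toℕ)
      s-multiple : ∀ r q → s (r + q * N) ≡ s r
      s-multiple r zero    = cong s (+-identityʳ r)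
      s-multiple r (suc q) = trans (cong s (trans (cong (r +_) (+-comm N (q * N))) (sym (+-assoc r (q * N) N)))) (trans
          (periodic (r + q * N)) (s-multiple r q))
      s-mod : ∀ i → s (i % N) ≡ s i
      s-mod i = sym (trans (cong s (m≡m%n+[m/n]*n i N)) (s-multiple (i % N) (i / N)))
      window-a : ∀ i → window n (cyclic a) i ≡ window n s i
      window-a i = window-cong n (cyclic a) s i i λ x → trans (cyclic-tabulate s (i + x)) (s-mod (i + x))
      window-mod : ∀ i → window n s (i % N) ≡ window n s i
      window-mod i = window-cong n s s (i % N) i λ x → trans (sym (s-mod (i % N + x))) (trans (cong s (%-absorbˡ i x N)) (s-mod (i + x)))
      inT : ∀ i → All IsHalf (window n (cyclic a) i)
      inT i = to (occurs _) (i , sym (window-a i))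
      close : ∀ (i j : Fin N) → N ∣ ∣ toℕ i - toℕ j ∣ → i ≡ j
      close i j N∣ with ∣ toℕ i - toℕ j ∣ in eq
      ... | zero  = toℕ-injective (∣m-n∣≡0⇒m≡n eq)
      ... | suc d = contradiction N∣ (>⇒∤ (subst (_< N) eq (≤-<-trans (∣m-n∣≤m⊔n (toℕ i) (toℕ j)) (⊔-lub (toℕ<n i) (toℕ<n j)))))
      once : ∀ e → All IsHalf e → _
      once e e∈ with from (occurs e) e∈
      ... | i , eq = i mod N , at , λ {j} eq′ → close (i mod N) j (distinct (toℕ (i mod N)) (toℕ j)
              (trans (sym (window-a (toℕ (i mod N)))) (trans at (trans (sym eq′) (window-a (toℕ j))))))
        where
        at : window n (cyclic a) (toℕ (i mod N)) ≡ e
        at = trans (window-a (toℕ (i mod N))) (trans (cong (window n s) (toℕ-mod i N)) (trans (window-mod i) eq))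

someBChoice : ∀ l m → BChoice (suc l) m
someBChoice l m with 2 ∣? suc l
... | no k-odd = odd k-odd
... | yes 2∣k  = let a , isCircuit = BinaryCircuit.eulerianCircuit l m 2∣k in even 2∣k a isCircuit

circuitFamily : ∀ l m (β : BChoice (suc l) (suc m)) → CircuitFamily (suc l) (suc m) (b β)
circuitFamily l m (odd k-odd)            = OddModulus.oddCircuits l k-odd (suc m)
circuitFamily l m (even 2∣k a isCircuit) = EvenCircuits.evenCircuits l m 2∣k a isCircuit

-- The number of edges of Z and the maximal sequence

module Count (l m : ℕ) (choice : CircuitChoice (suc l) m) {B : Fin (suc l) → Pred (Tuple (suc l) (2 + m)) 0ℓ}
             (circuits : CircuitFamily (suc l) m B) where

  open Residues l
  open Differences l
  open ZGraph l m choice circuits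

  private
    k : ℕ
    k = suc l

    es : List (Tuple k (2 + m))
    es = edgeList succession

  -- Every tuple is an edge, the negative of an edge or self-negative.
  count : ∀ xs → Unique xs → (∀ {u} → u ∈ˡ xs ⇔ ⊝ u ≡ u) →
          k ^ (2 + m) ≡ length es * 2 + length xs ^ (2 + m)
  count xs xs! ∈xs = begin
    k ^ (2 + m)                                        ≡⟨ cong (_^ (2 + m)) (Listₚ.length-tabulate {n = k} (λ i → i)) ⟨
    length (allFin k) ^ (2 + m)                        ≡⟨ length-tuples (allFin k) (2 + m) ⟨
    length (tuples (allFin k) (2 + m))                 ≡⟨ ↭-length partition ⟩
    length (es ++ List.map neg es ++ selves)           ≡⟨ Listₚ.length-++ es ⟩
    length es + length (List.map neg es ++ selves)     ≡⟨ cong (length es +_) (Listₚ.length-++ (List.map neg es)) ⟩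
    length es + (length (List.map neg es) + length selves) ≡⟨ cong₂ (λ p q → length es + (p + q))
        (Listₚ.length-map neg es) (length-tuples xs (2 + m)) ⟩
    length es + (length es + length xs ^ (2 + m))      ≡⟨ regroup (length es) (length xs ^ (2 + m)) ⟩
    length es * 2 + length xs ^ (2 + m)                ∎
    where
    open ≡-Reasoning
    regroup : ∀ p q → p + (p + q) ≡ p * 2 + q
    regroup = solve-∀
    selves : List (Tuple k (2 + m))
    selves = tuples xs (2 + m)
    inE : ∀ {e} → e ∈ˡ es → e ∈ Zᴱ
    inE = to (∈-edgeList succession)
    negE : ∀ {e} → e ∈ˡ List.map neg es → neg e ∈ Zᴱ
    negE e∈ with ∈-map⁻ neg e∈
    ... | e′ , e′∈ , refl = subst (_∈ Zᴱ) (sym (neg-involutive e′)) (inE e′∈)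
    self : ∀ {e} → e ∈ˡ selves → neg e ≡ e
    self e∈ = to (neg-pointwise ∈xs) (∈-tuples⁻ xs e∈)
    negsAndSelves : Unique (List.map neg es ++ selves)
    negsAndSelves = Unique.++⁺
      (Unique.map⁺ (λ {u} {v} eq → trans (sym (neg-involutive u)) (trans (cong neg eq) (neg-involutive v))) (edgeList-unique succession))
      (tuples-unique xs! (2 + m))
      (λ (e∈ , e-self) → exclusive (negE e∈) (subst (_∈ Zᴱ) (sym (cong neg (self e-self))) (negE e∈)))
    everything : Unique (es ++ List.map neg es ++ selves)
    everything = Unique.++⁺ (edgeList-unique succession) negsAndSelves λ (e∈ , e∈′) →
      [ (λ -e∈ → exclusive (inE e∈) (negE -e∈))
      , (λ e-self → exclusive (inE e∈) (subst (_∈ Zᴱ) (sym (self e-self)) (inE e∈))) ]′ (∈-++⁻ (List.map neg es) e∈′)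
    classify : ∀ e → e ∈ˡ es ++ List.map neg es ++ selves
    classify e with neg e ≟ᵗ e
    ... | yes e-self = ∈-++⁺ʳ es (∈-++⁺ʳ (List.map neg es) (∈-tuples⁺ xs (from (neg-pointwise ∈xs) e-self)))
    ... | no e≢ = [ (λ e∈ → ∈-++⁺ˡ (from (∈-edgeList succession) e∈))
                  , (λ -e∈ → ∈-++⁺ʳ es (∈-++⁺ˡ (subst (_∈ˡ List.map neg es) (neg-involutive e) (∈-map⁺ neg (from
                      (∈-edgeList succession) -e∈))))) ]′
                  (exhaustive e e≢)
    partition : tuples (allFin k) (2 + m) ↭ es ++ List.map neg es ++ selves
    partition = sameElements⇒↭ (tuples-unique (Unique.allFin⁺ k) (2 + m)) everything
      (mk⇔ (λ _ → classify _) (λ _ → ∈-tuples-allFin _))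

  halve : ∀ {N p q} → N ≡ p * 2 + q → p ≡ (N ∸ q) / 2
  halve {N} {p} {q} eq = sym (trans (cong (λ a → (a ∸ q) / 2) eq) (trans (cong (_/ 2) (m+n∸n≡m (p * 2) q)) (m*n/n≡m p 2)))

  size-odd : ¬ 2 ∣ k → length es ≡ (k ^ (2 + m) ∸ 1) / 2
  size-odd k-odd = halve (trans (count (Fin.zero ∷ []) (Allˡ.[] ∷ [])
      (mk⇔ (λ { (here refl) → ⊝-zero }) (λ eq → here (OddModulus.selfNegative⇒zero l k-odd _ eq))))
    (cong (length es * 2 +_) (^-zeroˡ (2 + m))))

  size-even : 2 ∣ k → length es ≡ (k ^ (2 + m) ∸ 2 ^ (2 + m)) / 2
  size-even 2∣k = halve (count halves halves-unique ∈-halves⇔selfNegative)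
    where open EvenModulus l 2∣k

module MaximalNAS (l m : ℕ) (2<k : 2 < 2 + l) (choice : CircuitChoice (2 + l) (suc m))
                  {B : Fin (2 + l) → Pred (Tuple (2 + l) (3 + m)) 0ℓ}
                  (circuits : CircuitFamily (2 + l) (suc m) B) where

  open Residues (suc l)
  open ZGraph (suc l) (suc m) choice circuits
  open ZConnected l m 2<k choice circuits using (connectedVertices)
  open Count (suc l) (suc m) choice circuits

  private
    k : ℕ
    k = 2 + l

  -- The tuple (1, 0, ..., 0) is not self-negative since k > 2, so it or its negative is an edge.
  someEdge : ∃ Zᴱ
  someEdge = [ _,_ e , _,_ (neg e) ]′ (exhaustive e λ eq → <-irrefl (trans (sym (doubleSelf (∷-injectiveˡ eq))) refl) 2<k)
    where
    one : Fin k
    one = Fin.suc Fin.zero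
    e : Tuple k (3 + m)
    e = one ∷ replicate (2 + m) Fin.zero
    doubleSelf : ⊝ one ≡ one → k ≡ 2
    doubleSelf eq = sym (selfNegative⇒doubleWeight≡k one eq)

  maximalNAS : ∃ λ s → ∃ λ p → IsMaximalNAS k (3 + m) s p
  maximalNAS = fromSequence (eulerianSequence succession someEdge λ {e} {e′} e∈ e′∈ →
      connectedVertices (init e) (init e′) (e , e∈ , inj₁ refl) (e′ , e′∈ , inj₁ refl))
    where
    fromSequence : ∃ (IsEulerianSequence succession) → ∃ λ s → ∃ λ p → IsMaximalNAS k (3 + m) s p
    fromSequence (s , isWindow , occurs) = s , length (edgeList succession) , record
      { isNAS = record
        { isWindowSequence = isWindow
        ; negativeAvoiding = λ a a-occurs -a-occurs → exclusive (to (occurs a) a-occurs) (to (occurs (neg a)) -a-occurs)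
        }
      ; period-odd  = size-odd
      ; period-even = size-even
      }

theorem7p2 : (k m : ℕ) → let n = suc m in
    3 ≤ k → 3 ≤ n → ¬ 2 ∣ n →
    ((choice : CircuitChoice k m) (β : BChoice k m) → Eulerian (Z choice β)) ×
    (∃ λ (s : ℕ → Fin k) → ∃ λ (p : ℕ) → IsMaximalNAS k (suc n) s p)
theorem7p2 (suc (suc l)) (suc m) 2<k _ n-odd =
  (λ choice β → ZConnected.eulerian l m 2<k choice (circuitFamily (suc l) m β)) ,
  -- Existence needs one instance of each choice; the choice of circuits is where n being odd
  -- enters.
  MaximalNAS.maximalNAS l m 2<k (ChoiceExists.circuitChoice (suc l) (suc m) n-odd) (circuitFamily (suc l) m (someBChoice (suc l) (suc m)))
theorem7p2 (suc zero) _ (s≤s ())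
theorem7p2 (suc (suc _)) zero _ (s≤s ())
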